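{- Let $n\ge4$. $\mathbb G^n_S$ is the orthogonal direct sum of the $n$-dimensional subspace $\mathbb{CPI}^n_S$ and the $\frac{n(n-3)}2$-dimensional subspace $\mathbb C^n_S$. Every $\mathcal G\in\mathbb G^n_S$ has a unique decomposition $\mathcal G=\mathcal G_{cpi}+\mathcal G_{cyclic}$ with $\mathcal G_{cpi}\in\mathbb{CPI}^n_S$ and $\mathcal G_{cyclic}\in\mathbb C^n_S$, these being the orthogonal projections of $\mathcal G$ onto the two subspaces.
   Context: $\mathbb G^n_S$ is the space of complete undirected weighted graphs without loops on $V_1,\dots,V_n$ with edge weights $d_{i,j}=d_{j,i}$, identified with $\mathbb R^{\binom n2}$ with the standard inner product. $\mathbb{CPI}^n_S$ is the subspace of graphs with $d_{j,k}=\omega_j+\omega_k$ for some reals $\omega_1,\dots,\omega_n$ (the closed path independent graphs). $\mathbb C^n_S$ is the span of all vectors $\mathbf b^n_{i,j,k,s}$ (distinct $i,j,k,s$) having $d_{i,j}=1,d_{j,k}=-1,d_{k,s}=1,d_{s,i}=-1$ and all other entries 0. -}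

module Defs where

open import Algebra.Bundles using (CommutativeMonoid; CommutativeRing)
open import Algebra.Module.Bundles using (Module)
open import Algebra.Module.Structures.Biased using (IsModuleFromLeft)
import Algebra.Properties.AbelianGroup as AbelianGroupProperties
import Algebra.Properties.CommutativeMonoid.Sum as CommutativeMonoidSum
import Algebra.Properties.CommutativeSemigroup as CommutativeSemigroupProperties
import Algebra.Properties.Ring as RingProperties
open import Data.Bool.Base using (if_then_else_)
open import Data.Fin.Base using (Fin)
open import Data.Fin.Properties using (_<?_)
open import Data.List.Base using ([]; _∷_)
open import Data.List.Relation.Unary.Unique.Propositional using (Unique)
open import Data.Nat.Base as ℕ using (ℕ)
import Data.Nat.Properties as ℕ
open import Data.Product.Base using (Σ; ∃; _×_; _,_)
open import Data.Rational.Base as ℚ using (ℚ; 0ℚ; 1ℚ; ½)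
import Data.Rational.Properties as ℚ
open import Data.Sum.Base using (_⊎_)
open import Level using (0ℓ)
open import Relation.Binary.PropositionalEquality using (_≡_; _≢_; refl; sym; trans; cong; cong₂; subst)
open import Relation.Nullary.Decidable.Core using (does)
open import Relation.Nullary.Negation.Core using (¬_)
open import Relation.Unary using (Pred; _∈_)

-- ℝ is the setoid of rational Cauchy sequences modulo null sequences; the ∃ in
-- IsCauchy makes the modulus of convergence part of a real number.

IsCauchy : (ℕ → ℚ) → Set
IsCauchy x = ∀ ε → 0ℚ ℚ.< ε →
  ∃ λ N → ∀ m n → N ℕ.≤ m → N ℕ.≤ n → ℚ.∣ x m ℚ.- x n ∣ ℚ.< ε

record ℝ : Set where
  no-eta-equality
  constructor mkℝ
  field
    seq    : ℕ → ℚ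
    cauchy : IsCauchy seq

open ℝ public

infix 4 _≃_

record _≃_ (x y : ℝ) : Set where
  constructor mk≃
  field
    null : ∀ ε → 0ℚ ℚ.< ε →
      ∃ λ N → ∀ n → N ℕ.≤ n → ℚ.∣ seq x n ℚ.- seq y n ∣ ℚ.< ε

open _≃_ public

private
  module ℚ⁺ = AbelianGroupProperties ℚ.+-0-abelianGroup
  module ℚ⁺ₛ = CommutativeSemigroupProperties
    (CommutativeMonoid.commutativeSemigroup ℚ.+-0-commutativeMonoid)
  module ℚᴿ = RingProperties ℚ.+-*-ring

  cancel : ∀ a b → (a ℚ.- b) ℚ.+ b ≡ a
  cancel a b = ℚ⁺.//-rightDividesˡ b a

  flip-- : ∀ a b → ℚ.- (a ℚ.- b) ≡ b ℚ.- a
  flip-- = ℚ⁺.⁻¹-anti-homo‿-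

  telescope : ∀ a b c → (a ℚ.- b) ℚ.+ (b ℚ.- c) ≡ a ℚ.- c
  telescope a b c = trans (sym (ℚ.+-assoc (a ℚ.- b) b (ℚ.- c)))
    (cong (ℚ._- c) (cancel a b))

  rearrange-+ : ∀ a b c d → (a ℚ.- b) ℚ.+ (c ℚ.- d) ≡ (a ℚ.+ c) ℚ.- (b ℚ.+ d)
  rearrange-+ a b c d = trans (ℚ⁺ₛ.interchange a (ℚ.- b) c (ℚ.- d))
    (cong ((a ℚ.+ c) ℚ.+_) (sym (ℚ.neg-distrib-+ b d)))

  rearrange-* : ∀ a b c d → a ℚ.* (c ℚ.- d) ℚ.+ d ℚ.* (a ℚ.- b) ≡ a ℚ.* c ℚ.- b ℚ.* d
  rearrange-* a b c d = trans
    (cong₂ ℚ._+_ (ℚᴿ.x[y-z]≈xy-xz a c d)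
      (trans (ℚ.*-comm d (a ℚ.- b)) (ℚᴿ.[y-z]x≈yx-zx d a b)))
    (telescope (a ℚ.* c) (a ℚ.* d) (b ℚ.* d))

  -- Both convergence conditions above are instances: see difference and gap.
  Small : (ℕ → ℕ → ℚ) → Set
  Small f = ∀ ε → 0ℚ ℚ.< ε →
    ∃ λ N → ∀ m n → N ℕ.≤ m → N ℕ.≤ n → ℚ.∣ f m n ∣ ℚ.< ε

  EventuallyBounded : (ℕ → ℚ) → Set
  EventuallyBounded x = ∃ λ B → (0ℚ ℚ.< B) ×
    (∃ λ N → ∀ n → N ℕ.≤ n → ℚ.∣ x n ∣ ℚ.≤ B)

  small-cong : ∀ {f g} → (∀ m n → f m n ≡ g m n) → Small f → Small g
  small-cong eq s ε ε>0 with s ε ε>0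
  ... | N , h = N , λ m n p q →
    subst (λ t → ℚ.∣ t ∣ ℚ.< ε) (eq m n) (h m n p q)

  half>0 : ∀ {ε} → 0ℚ ℚ.< ε → 0ℚ ℚ.< ½ ℚ.* ε
  half>0 {ε} ε>0 = subst (ℚ._< ½ ℚ.* ε) (ℚ.*-zeroʳ ½) (ℚ.*-monoʳ-<-pos ½ ε>0)

  half+half : ∀ ε → ½ ℚ.* ε ℚ.+ ½ ℚ.* ε ≡ ε
  half+half ε = trans (sym (ℚ.*-distribʳ-+ ε ½ ½)) (ℚ.*-identityˡ ε)

  small-+ : ∀ f g → Small f → Small g → Small (λ m n → f m n ℚ.+ g m n)
  small-+ f g s t ε ε>0 with s (½ ℚ.* ε) (half>0 ε>0) | t (½ ℚ.* ε) (half>0 ε>0)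
  ... | N , h | M , k = N ℕ.⊔ M , λ m n p q →
    ℚ.≤-<-trans (ℚ.∣p+q∣≤∣p∣+∣q∣ (f m n) (g m n))
      (subst (ℚ.∣ f m n ∣ ℚ.+ ℚ.∣ g m n ∣ ℚ.<_) (half+half ε)
        (ℚ.+-mono-<
          (h m n (ℕ.m⊔n≤o⇒m≤o N M p) (ℕ.m⊔n≤o⇒m≤o N M q))
          (k m n (ℕ.m⊔n≤o⇒n≤o N M p) (ℕ.m⊔n≤o⇒n≤o N M q))))

  small-neg : ∀ f → Small f → Small (λ m n → ℚ.- f m n)
  small-neg f s ε ε>0 with s ε ε>0
  ... | N , h = N , λ m n p q →
    subst (ℚ._< ε) (sym (ℚ.∣-p∣≡∣p∣ (f m n))) (h m n p q)

  small-swap : ∀ f → Small f → Small (λ m n → f n m)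
  small-swap f s ε ε>0 with s ε ε>0
  ... | N , h = N , λ m n p q → h n m q p

  small-* : ∀ x f → EventuallyBounded x → Small f → Small (λ m n → x m ℚ.* f m n)
  small-* x f (B , B>0 , M , b) s ε ε>0 = result
    where
    instance
      posB : ℚ.Positive B
      posB = ℚ.positive B>0
      nzB : ℚ.NonZero B
      nzB = ℚ.pos⇒nonZero B
      pos1/B : ℚ.Positive (ℚ.1/ B)
      pos1/B = ℚ.1/pos⇒pos B
    δ : ℚ
    δ = ℚ.1/ B ℚ.* ε
    δ>0 : 0ℚ ℚ.< δ
    δ>0 = subst (ℚ._< δ) (ℚ.*-zeroʳ (ℚ.1/ B)) (ℚ.*-monoʳ-<-pos (ℚ.1/ B) ε>0)
    Bδ≡ε : B ℚ.* δ ≡ ε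
    Bδ≡ε = trans (sym (ℚ.*-assoc B (ℚ.1/ B) ε))
      (trans (cong (ℚ._* ε) (ℚ.*-inverseʳ B)) (ℚ.*-identityˡ ε))
    result : ∃ λ N → ∀ m n → N ℕ.≤ m → N ℕ.≤ n → ℚ.∣ x m ℚ.* f m n ∣ ℚ.< ε
    result with s δ δ>0
    ... | N , h = N ℕ.⊔ M , λ m n p q →
      subst (ℚ._< ε) (sym (ℚ.∣p*q∣≡∣p∣*∣q∣ (x m) (f m n)))
        (ℚ.≤-<-trans
          (ℚ.*-monoʳ-≤-nonNeg ℚ.∣ f m n ∣ {{ℚ.∣-∣-nonNeg (f m n)}}
            (b m (ℕ.m⊔n≤o⇒n≤o N M p)))
          (subst (B ℚ.* ℚ.∣ f m n ∣ ℚ.<_) Bδ≡ε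
            (ℚ.*-monoʳ-<-pos B
              (h m n (ℕ.m⊔n≤o⇒m≤o N M p) (ℕ.m⊔n≤o⇒m≤o N M q)))))

  difference : ℝ → ℕ → ℕ → ℚ
  difference x m n = seq x m ℚ.- seq x n

  bounded : ∀ x → EventuallyBounded (seq x)
  bounded x with cauchy x 1ℚ (ℚ.positive⁻¹ 1ℚ)
  ... | N , h = 1ℚ ℚ.+ ℚ.∣ seq x N ∣
              , ℚ.+-mono-<-≤ (ℚ.positive⁻¹ 1ℚ) (ℚ.0≤∣p∣ (seq x N))
              , N
              , λ n p → subst (λ t → ℚ.∣ t ∣ ℚ.≤ 1ℚ ℚ.+ ℚ.∣ seq x N ∣) (cancel (seq x n) (seq x N))
                  (ℚ.≤-trans (ℚ.∣p+q∣≤∣p∣+∣q∣ (difference x n N) (seq x N))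
                    (ℚ.+-monoˡ-≤ ℚ.∣ seq x N ∣ (ℚ.<⇒≤ (h n N p ℕ.≤-refl))))

infixl 6 _+_
infixl 7 _*_
infix  8 -_

_+_ : ℝ → ℝ → ℝ
seq (x + y) n = seq x n ℚ.+ seq y n
cauchy (x + y) = small-cong
  (λ m n → rearrange-+ (seq x m) (seq x n) (seq y m) (seq y n))
  (small-+ (difference x) (difference y) (cauchy x) (cauchy y))

-_ : ℝ → ℝ
seq (- x) n = ℚ.- seq x n
cauchy (- x) = small-cong
  (λ m n → ℚ.neg-distrib-+ (seq x m) (ℚ.- seq x n))
  (small-neg (difference x) (cauchy x))

_*_ : ℝ → ℝ → ℝ
seq (x * y) n = seq x n ℚ.* seq y n
cauchy (x * y) = small-cong
  (λ m n → rearrange-* (seq x m) (seq x n) (seq y m) (seq y n))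
  (small-+ (λ m n → seq x m ℚ.* difference y m n) (λ m n → seq y n ℚ.* difference x m n)
    (small-* (seq x) (difference y) (bounded x) (cauchy y))
    (small-swap (λ m n → seq y m ℚ.* difference x n m)
      (small-* (seq y) (λ m n → difference x n m) (bounded y)
        (small-swap (difference x) (cauchy x)))))

fromℚ : ℚ → ℝ
seq (fromℚ q) _ = q
cauchy (fromℚ q) ε ε>0 = 0 , λ _ _ _ _ →
  subst (ℚ._< ε) (sym (cong ℚ.∣_∣ (ℚ.+-inverseʳ q))) ε>0

0ℝ 1ℝ : ℝ
0ℝ = fromℚ 0ℚ
1ℝ = fromℚ 1ℚ

private
  gap : ℝ → ℝ → ℕ → ℕ → ℚ
  gap x y m _ = seq x m ℚ.- seq y m

  ≃⇒small : ∀ {x y} → x ≃ y → Small (gap x y)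
  ≃⇒small (mk≃ e) ε ε>0 with e ε ε>0
  ... | N , h = N , λ m _ p _ → h m p

  small⇒≃ : ∀ {x y} → Small (gap x y) → x ≃ y
  small⇒≃ s = mk≃ λ ε ε>0 → let (N , h) = s ε ε>0 in N , λ n p → h n n p p

  ≗⇒≃ : ∀ {x y} → (∀ n → seq x n ≡ seq y n) → x ≃ y
  ≗⇒≃ {x} {y} e = mk≃ λ ε ε>0 → 0 , λ n _ →
    subst (ℚ._< ε)
      (sym (cong ℚ.∣_∣ (trans (cong (ℚ._- seq y n) (e n)) (ℚ.+-inverseʳ (seq y n)))))
      ε>0

  ≃-refl : ∀ {x} → x ≃ x
  ≃-refl = ≗⇒≃ (λ _ → refl)

  ≃-sym : ∀ {x y} → x ≃ y → y ≃ x
  ≃-sym {x} {y} e = small⇒≃ (small-cong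
    (λ m _ → flip-- (seq x m) (seq y m))
    (small-neg (gap x y) (≃⇒small e)))

  ≃-trans : ∀ {x y z} → x ≃ y → y ≃ z → x ≃ z
  ≃-trans {x} {y} {z} e f = small⇒≃ (small-cong
    (λ m _ → telescope (seq x m) (seq y m) (seq z m))
    (small-+ (gap x y) (gap y z) (≃⇒small e) (≃⇒small f)))

  +-cong : ∀ {x x′ y y′} → x ≃ x′ → y ≃ y′ → x + y ≃ x′ + y′
  +-cong {x} {x′} {y} {y′} e f = small⇒≃ (small-cong
    (λ m _ → rearrange-+ (seq x m) (seq x′ m) (seq y m) (seq y′ m))
    (small-+ (gap x x′) (gap y y′) (≃⇒small e) (≃⇒small f)))

  -‿cong : ∀ {x y} → x ≃ y → - x ≃ - y
  -‿cong {x} {y} e = small⇒≃ (small-cong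
    (λ m _ → ℚ.neg-distrib-+ (seq x m) (ℚ.- seq y m))
    (small-neg (gap x y) (≃⇒small e)))

  *-cong : ∀ {x x′ y y′} → x ≃ x′ → y ≃ y′ → x * y ≃ x′ * y′
  *-cong {x} {x′} {y} {y′} e f = small⇒≃ (small-cong
    (λ m _ → rearrange-* (seq x m) (seq x′ m) (seq y m) (seq y′ m))
    (small-+ (λ m n → seq x m ℚ.* gap y y′ m n) (λ m n → seq y′ m ℚ.* gap x x′ m n)
      (small-* (seq x) (gap y y′) (bounded x) (≃⇒small f))
      (small-* (seq y′) (gap x x′) (bounded y′) (≃⇒small e))))

ℝ-commutativeRing : CommutativeRing 0ℓ 0ℓ
ℝ-commutativeRing = record
  { Carrier = ℝ
  ; _≈_     = _≃_
  ; _+_     = _+_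
  ; _*_     = _*_
  ; -_      = -_
  ; 0#      = 0ℝ
  ; 1#      = 1ℝ
  ; isCommutativeRing = record
    { isRing = record
      { +-isAbelianGroup = record
        { isGroup = record
          { isMonoid = record
            { isSemigroup = record
              { isMagma = record
                { isEquivalence = record { refl = ≃-refl ; sym = ≃-sym ; trans = ≃-trans }
                ; ∙-cong = +-cong
                }
              ; assoc = λ x y z → ≗⇒≃ λ n → ℚ.+-assoc (seq x n) (seq y n) (seq z n)
              }
            ; identity = (λ x → ≗⇒≃ λ n → ℚ.+-identityˡ (seq x n))
                       , (λ x → ≗⇒≃ λ n → ℚ.+-identityʳ (seq x n))
            }
          ; inverse = (λ x → ≗⇒≃ λ n → ℚ.+-inverseˡ (seq x n))
                    , (λ x → ≗⇒≃ λ n → ℚ.+-inverseʳ (seq x n))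
          ; ⁻¹-cong = -‿cong
          }
        ; comm = λ x y → ≗⇒≃ λ n → ℚ.+-comm (seq x n) (seq y n)
        }
      ; *-cong = *-cong
      ; *-assoc = λ x y z → ≗⇒≃ λ n → ℚ.*-assoc (seq x n) (seq y n) (seq z n)
      ; *-identity = (λ x → ≗⇒≃ λ n → ℚ.*-identityˡ (seq x n))
                   , (λ x → ≗⇒≃ λ n → ℚ.*-identityʳ (seq x n))
      ; distrib = (λ x y z → ≗⇒≃ λ n → ℚ.*-distribˡ-+ (seq x n) (seq y n) (seq z n))
                , (λ x y z → ≗⇒≃ λ n → ℚ.*-distribʳ-+ (seq x n) (seq y n) (seq z n))
      }
    ; *-comm = λ x y → ≗⇒≃ λ n → ℚ.*-comm (seq x n) (seq y n)
    }
  }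

module LinearAlgebra
  (V : Module ℝ-commutativeRing 0ℓ 0ℓ)
  (⟨_,_⟩ : Module.Carrierᴹ V → Module.Carrierᴹ V → ℝ)
  where

  open Module V using (Carrierᴹ; _≈ᴹ_; _+ᴹ_; _*ₗ_; 0ᴹ; -ᴹ_; +ᴹ-commutativeMonoid)
  open CommutativeMonoidSum +ᴹ-commutativeMonoid using (sum)

  record IsSubspace (W : Pred Carrierᴹ 0ℓ) : Set where
    field
      respects-≈ : ∀ {u v} → u ≈ᴹ v → u ∈ W → v ∈ W
      0-closed   : 0ᴹ ∈ W
      +-closed   : ∀ {u v} → u ∈ W → v ∈ W → (u +ᴹ v) ∈ W
      *-closed   : ∀ c {v} → v ∈ W → (c *ₗ v) ∈ W

  linearCombination : ∀ {m} → (Fin m → ℝ) → (Fin m → Carrierᴹ) → Carrierᴹ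
  linearCombination c v = sum (λ i → c i *ₗ v i)

  Span : Pred Carrierᴹ 0ℓ → Pred Carrierᴹ 0ℓ
  Span S v = ∃ λ m → Σ (Fin m → ℝ) λ c → Σ (Fin m → Carrierᴹ) λ u →
    (∀ i → u i ∈ S) × v ≈ᴹ linearCombination c u

  LinearlyIndependent : ∀ {m} → (Fin m → Carrierᴹ) → Set
  LinearlyIndependent v =
    ∀ c → linearCombination c v ≈ᴹ 0ᴹ → ∀ i → c i ≃ 0ℝ

  record IsBasis (W : Pred Carrierᴹ 0ℓ) {m : ℕ} (v : Fin m → Carrierᴹ) : Set where
    field
      contained   : ∀ i → v i ∈ W
      independent : LinearlyIndependent v
      spanning    : ∀ w → w ∈ W → ∃ λ c → w ≈ᴹ linearCombination c v

  HasDimension : Pred Carrierᴹ 0ℓ → ℕ → Set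
  HasDimension W m = Σ (Fin m → Carrierᴹ) (IsBasis W)

  record IsOrthogonalDirectSum (U W : Pred Carrierᴹ 0ℓ) : Set where
    field
      sum-is-everything    : ∀ v → ∃ λ u → ∃ λ w → u ∈ U × w ∈ W × v ≈ᴹ u +ᴹ w
      trivial-intersection : ∀ v → v ∈ U → v ∈ W → v ≈ᴹ 0ᴹ
      orthogonal           : ∀ u w → u ∈ U → w ∈ W → ⟨ u , w ⟩ ≃ 0ℝ

  record IsOrthogonalProjection (W : Pred Carrierᴹ 0ℓ) (v p : Carrierᴹ) : Set where
    field
      projection∈W        : p ∈ W
      residual-orthogonal : ∀ w → w ∈ W → ⟨ v +ᴹ (-ᴹ p) , w ⟩ ≃ 0ℝ

-- Complete undirected weighted graph on n vertices, as a symmetric weight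
-- matrix; having no loops is encoded by a zero diagonal, so that the entries
-- with i < j are free coordinates.
record Graph (n : ℕ) : Set where
  no-eta-equality
  field
    weight    : Fin n → Fin n → ℝ
    symmetric : ∀ i j → weight i j ≃ weight j i
    loopless  : ∀ i → weight i i ≃ 0ℝ

open Graph public

infix 4 _≈ᴳ_

record _≈ᴳ_ {n : ℕ} (𝒢 ℋ : Graph n) : Set where
  constructor mk≈ᴳ
  field
    weights-≃ : ∀ i j → weight 𝒢 i j ≃ weight ℋ i j

open _≈ᴳ_ public

private
  module R where
    open CommutativeRing ℝ-commutativeRing public
    open RingProperties ring public using (-0#≈0#)

infixl 6 _+ᴳ_
infixl 7 _*ᴳ_
infix  8 -ᴳ_

_+ᴳ_ : ∀ {n} → Graph n → Graph n → Graph n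
weight    (𝒢 +ᴳ ℋ) i j = weight 𝒢 i j + weight ℋ i j
symmetric (𝒢 +ᴳ ℋ) i j = +-cong (symmetric 𝒢 i j) (symmetric ℋ i j)
loopless  (𝒢 +ᴳ ℋ) i   = ≃-trans (+-cong (loopless 𝒢 i) (loopless ℋ i)) (R.+-identityˡ 0ℝ)

_*ᴳ_ : ∀ {n} → ℝ → Graph n → Graph n
weight    (c *ᴳ 𝒢) i j = c * weight 𝒢 i j
symmetric (c *ᴳ 𝒢) i j = *-cong ≃-refl (symmetric 𝒢 i j)
loopless  (c *ᴳ 𝒢) i   = ≃-trans (*-cong ≃-refl (loopless 𝒢 i)) (R.zeroʳ c)

-ᴳ_ : ∀ {n} → Graph n → Graph n
weight    (-ᴳ 𝒢) i j = - weight 𝒢 i j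
symmetric (-ᴳ 𝒢) i j = -‿cong (symmetric 𝒢 i j)
loopless  (-ᴳ 𝒢) i   = ≃-trans (-‿cong (loopless 𝒢 i)) R.-0#≈0#

0ᴳ : ∀ {n} → Graph n
weight    0ᴳ _ _ = 0ℝ
symmetric 0ᴳ _ _ = ≃-refl
loopless  0ᴳ _   = ≃-refl

𝔾 : ℕ → Module ℝ-commutativeRing 0ℓ 0ℓ
𝔾 n = record
  { Carrierᴹ = Graph n
  ; _≈ᴹ_     = _≈ᴳ_
  ; _+ᴹ_     = _+ᴳ_
  ; _*ₗ_     = _*ᴳ_
  ; _*ᵣ_     = λ 𝒢 c → c *ᴳ 𝒢
  ; 0ᴹ       = 0ᴳ
  ; -ᴹ_      = -ᴳ_
  ; isModule = IsModuleFromLeft.isModule {commutativeRing = ℝ-commutativeRing} record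
    { isLeftModule = record
      { isLeftSemimodule = record
        { +ᴹ-isCommutativeMonoid = record
          { isMonoid = record
            { isSemigroup = record
              { isMagma = record
                { isEquivalence = record
                  { refl  = mk≈ᴳ λ _ _ → ≃-refl
                  ; sym   = λ (mk≈ᴳ e) → mk≈ᴳ λ i j → ≃-sym (e i j)
                  ; trans = λ (mk≈ᴳ e) (mk≈ᴳ f) → mk≈ᴳ λ i j → ≃-trans (e i j) (f i j)
                  }
                ; ∙-cong = λ (mk≈ᴳ e) (mk≈ᴳ f) → mk≈ᴳ λ i j → +-cong (e i j) (f i j)
                }
              ; assoc = λ _ _ _ → mk≈ᴳ λ _ _ → R.+-assoc _ _ _
              }
            ; identity = (λ _ → mk≈ᴳ λ _ _ → R.+-identityˡ _)
                       , (λ _ → mk≈ᴳ λ _ _ → R.+-identityʳ _)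
            }
          ; comm = λ _ _ → mk≈ᴳ λ _ _ → R.+-comm _ _
          }
        ; isPreleftSemimodule = record
          { *ₗ-cong      = λ e (mk≈ᴳ f) → mk≈ᴳ λ i j → *-cong e (f i j)
          ; *ₗ-zeroˡ     = λ _ → mk≈ᴳ λ _ _ → R.zeroˡ _
          ; *ₗ-distribʳ  = λ _ _ _ → mk≈ᴳ λ _ _ → R.distribʳ _ _ _
          ; *ₗ-identityˡ = λ _ → mk≈ᴳ λ _ _ → R.*-identityˡ _
          ; *ₗ-assoc     = λ _ _ _ → mk≈ᴳ λ _ _ → R.*-assoc _ _ _
          ; *ₗ-zeroʳ     = λ _ → mk≈ᴳ λ _ _ → R.zeroʳ _
          ; *ₗ-distribˡ  = λ _ _ _ → mk≈ᴳ λ _ _ → R.distribˡ _ _ _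
          }
        }
      ; -ᴹ‿cong    = λ (mk≈ᴳ e) → mk≈ᴳ λ i j → -‿cong (e i j)
      ; -ᴹ‿inverse = (λ _ → mk≈ᴳ λ _ _ → R.-‿inverseˡ _)
                   , (λ _ → mk≈ᴳ λ _ _ → R.-‿inverseʳ _)
      }
    }
  }

-- The standard inner product of ℝ^(n choose 2): each edge is counted once.
⟨_,_⟩ᴳ : ∀ {n} → Graph n → Graph n → ℝ
⟨_,_⟩ᴳ {n} 𝒢 ℋ =
  ∑[ i < n ] ∑[ j < n ]
    (if does (i <? j) then weight 𝒢 i j * weight ℋ i j else 0ℝ)
  where open CommutativeMonoidSum R.+-commutativeMonoid using (sum-syntax)

module 𝔾-LinearAlgebra (n : ℕ) = LinearAlgebra (𝔾 n) ⟨_,_⟩ᴳ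

ℂℙ𝕀 : ∀ n → Pred (Graph n) 0ℓ
ℂℙ𝕀 n 𝒢 = Σ (Fin n → ℝ) λ ω → ∀ j k → j ≢ k → weight 𝒢 j k ≃ ω j + ω k

SameEdge : ∀ {n} (i j p q : Fin n) → Set
SameEdge i j p q = (p ≡ i × q ≡ j) ⊎ (p ≡ j × q ≡ i)

-- Is-𝐛 i j k s 𝒢 says that 𝒢 is the vector 𝐛 indexed by i, j, k, s.
record Is-𝐛 {n : ℕ} (i j k s : Fin n) (𝒢 : Graph n) : Set where
  field
    distinct : Unique (i ∷ j ∷ k ∷ s ∷ [])
    d-ij     : weight 𝒢 i j ≃ 1ℝ
    d-jk     : weight 𝒢 j k ≃ - 1ℝ
    d-ks     : weight 𝒢 k s ≃ 1ℝ
    d-si     : weight 𝒢 s i ≃ - 1ℝ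
    d-other  : ∀ p q → ¬ SameEdge i j p q → ¬ SameEdge j k p q →
               ¬ SameEdge k s p q → ¬ SameEdge s i p q → weight 𝒢 p q ≃ 0ℝ

ℂ : ∀ n → Pred (Graph n) 0ℓ
ℂ n = Span λ 𝒢 → ∃ λ i → ∃ λ j → ∃ λ k → ∃ λ s → Is-𝐛 i j k s 𝒢
  where open 𝔾-LinearAlgebra n using (Span)

{-# OPTIONS --safe #-}
module Submission where

-- Both summands are described by the row sums of the weight matrix.  A graph with weights
-- ω j + ω k is orthogonal to every graph all of whose row sums vanish (a balanced graph),
-- and it is determined by its row sums (n - 2) ω p + ∑ ω, which can be prescribed at will;
-- so ℂℙ𝕀 is an orthogonal complement of the balanced graphs.  The 4-cycles 𝐛 are balanced.
-- Conversely, a balanced graph is determined by its weights on the chords, the edges that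
-- avoid the vertex 0 and differ from 12, and each chord ab has a dual vector T ab - T 12,
-- where T ab = e ab - e 0a - e 0b; differences T ab - T ac are 4-cycles, so these vectors
-- form a basis of ℂ.

open import Algebra.Bundles using (CommutativeRing)
open import Algebra.Module.Bundles using (Module)
import Algebra.Properties.Group as GroupProperties
import Algebra.Properties.Semiring.Sum as SemiringSum
import Algebra.Solver.Ring as RingSolver
open import Algebra.Solver.Ring.AlmostCommutativeRing using (fromCommutativeRing; _-Raw-AlmostCommutative⟶_)
open import Data.Bool.Base using (true; false; if_then_else_)
open import Data.Fin.Base using (Fin; zero; suc; _<_; splitAt; join)
open import Data.Fin.Properties using (_≟_; _<?_; <-cmp; <-asym; <⇒≢; suc-injective; splitAt-join; join-splitAt)
open import Data.List.Base using ([]; _∷_)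
open import Data.List.Relation.Unary.All using ([]; _∷_)
open import Data.List.Relation.Unary.AllPairs using ([]; _∷_)
open import Data.List.Relation.Unary.Unique.Propositional using (Unique)
import Data.Maybe.Base as Maybe
open import Data.Nat.Base as ℕ using (ℕ; zero; suc; _≤_; _*_; _∸_)
open import Data.Nat.DivMod using (_/_; m*n/n≡m)
open import Data.Nat.Solver using (module +-*-Solver)
open import Data.Product.Base as Product using (∃; _×_; _,_; proj₁; proj₂)
open import Data.Rational.Base as ℚ using (0ℚ; 1ℚ; ½)
import Data.Rational.Properties as ℚ
open import Data.Sum.Base using (inj₁; inj₂; [_,_]′)
import Data.Vec.Functional as Vector
open import Function.Base using (_∘_)
open import Level using (0ℓ)
open import Relation.Binary.Definitions using (tri<; tri≈; tri>)
open import Relation.Binary.PropositionalEquality as ≡ using (_≡_; _≢_; ≢-sym)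
open import Relation.Nullary.Decidable using (Dec; yes; no; does; dec⇒maybe; dec-true; dec-false; _×-dec_; _⊎-dec_)
open import Relation.Nullary.Negation using (¬_; contradiction)
open import Relation.Unary using (Pred; _∈_; _⊆_)
open import Defs renaming (_*_ to _·_)
open 𝔾-LinearAlgebra using (IsSubspace; HasDimension; IsOrthogonalDirectSum; IsOrthogonalProjection; linearCombination)

module ℝ-Ring = CommutativeRing ℝ-commutativeRing
open ℝ-Ring
  using (refl; sym; trans; +-cong; +-congˡ; +-congʳ; +-comm; +-identityˡ; +-identityʳ; -‿cong; -‿inverseʳ; zeroˡ; zeroʳ)
  renaming (*-cong to ·-cong; *-congˡ to ·-congˡ; *-congʳ to ·-congʳ; *-comm to ·-comm; *-identityˡ to ·-identityˡ; *-identityʳ to ·-identityʳ; reflexive to ≡⇒≃)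
open SemiringSum ℝ-Ring.semiring
  using (sum; sum-syntax; sum-cong-≋; sum-replicate-zero; ∑-distrib-+; ∑-comm; *-distribˡ-sum; *-distribʳ-sum)
open import Relation.Binary.Reasoning.Setoid ℝ-Ring.setoid
open +-*-Solver
  using () renaming (solve to solveℕ; _:=_ to _:≡_; _:+_ to _:⊕_; _:*_ to _:⊗_; con to conℕ)

-- Real equality and a ring solver with rational coefficients

≗⇒≃ : ∀ {x y} → (∀ n → seq x n ≡ seq y n) → x ≃ y
≗⇒≃ {x} {y} e = mk≃ λ ε ε>0 → 0 , λ n _ → ≡.subst (ℚ._< ε)
  (≡.sym (≡.cong ℚ.∣_∣ (≡.trans (≡.cong (ℚ._- seq y n) (e n)) (ℚ.+-inverseʳ (seq y n))))) ε>0

-- The solver has to compare coefficients, which is decidable on `ℚ`; rational coefficients also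
-- admit ½ in the identities below.
fromℚ-homomorphism : ℚ.+-*-rawRing -Raw-AlmostCommutative⟶ fromCommutativeRing ℝ-commutativeRing
fromℚ-homomorphism = record
  { ⟦_⟧    = fromℚ
  ; +-homo = λ _ _ → ≗⇒≃ λ _ → ≡.refl
  ; *-homo = λ _ _ → ≗⇒≃ λ _ → ≡.refl
  ; -‿homo = λ _ → ≗⇒≃ λ _ → ≡.refl
  ; 0-homo = refl
  ; 1-homo = refl
  }

open RingSolver ℚ.+-*-rawRing (fromCommutativeRing ℝ-commutativeRing) fromℚ-homomorphism
  (λ p q → Maybe.map (λ e → ≡⇒≃ (≡.cong fromℚ e)) (dec⇒maybe (p ℚ.≟ q)))
  using (solve; _:=_; _:+_; _:*_; :-_; con)

-- Finite sums, the Kronecker delta, and natural numbers as reals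

sum-zero : ∀ {n} {f : Fin n → ℝ} → (∀ i → f i ≃ 0ℝ) → sum f ≃ 0ℝ
sum-zero {n} f≃0 = trans (sum-cong-≋ f≃0) (sum-replicate-zero n)

sum-single : ∀ {n} {f : Fin n → ℝ} i → (∀ j → j ≢ i → f j ≃ 0ℝ) → sum f ≃ f i
sum-single {f = f} zero f≃0 =
  trans (+-congˡ (sum-zero λ j → f≃0 (suc j) λ ())) (+-identityʳ (f zero))
sum-single {f = f} (suc i) f≃0 = trans
  (+-cong (f≃0 zero λ ()) (sum-single i λ j j≢i → f≃0 (suc j) (j≢i ∘ suc-injective)))
  (+-identityˡ (f (suc i)))

δ : ∀ {n} → Fin n → Fin n → ℝ
δ p q = if does (p ≟ q) then 1ℝ else 0ℝ

δ-≡ : ∀ {n} {p q : Fin n} → p ≡ q → δ p q ≃ 1ℝ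
δ-≡ {p = p} {q} p≡q rewrite dec-true (p ≟ q) p≡q = refl

δ-≢ : ∀ {n} {p q : Fin n} → p ≢ q → δ p q ≃ 0ℝ
δ-≢ {p = p} {q} p≢q rewrite dec-false (p ≟ q) p≢q = refl

δ-sym : ∀ {n} (p q : Fin n) → δ p q ≃ δ q p
δ-sym p q with p ≟ q
... | yes p≡q = sym (δ-≡ (≡.sym p≡q))
... | no  p≢q = sym (δ-≢ (p≢q ∘ ≡.sym))

sum-δ : ∀ {n} (f : Fin n → ℝ) i → ∑[ j < n ] (δ j i · f j) ≃ f i
sum-δ f i = begin
  sum (λ j → δ j i · f j) ≈⟨ sum-single i (λ j j≢i → trans (·-congʳ (δ-≢ j≢i)) (zeroˡ (f j))) ⟩
  δ i i · f i             ≈⟨ ·-congʳ (δ-≡ {p = i} ≡.refl) ⟩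
  1ℝ · f i                ≈⟨ ·-identityˡ (f i) ⟩
  f i                     ∎

-- The number n as a real. Being a sum of ones, `card (suc n)` unfolds to `1ℝ + card n`, the form in
-- which the solver meets it.
card : ℕ → ℝ
card n = ∑[ _ < n ] 1ℝ

sum-const : ∀ n x → ∑[ _ < n ] x ≃ card n · x
sum-const n x = sym (trans (*-distribʳ-sum x (λ (_ : Fin n) → 1ℝ)) (sum-cong-≋ λ (_ : Fin n) → ·-identityˡ x))

-- Inversion is done in `ℚ`: with q nonnegative, 1 + q is positive, and the constant sequence at its
-- reciprocal inverts `card (suc n)`.
cardℚ : ∀ n → ∃ λ q → ℚ.NonNegative q × card n ≃ fromℚ q
cardℚ zero    = 0ℚ , _ , refl
cardℚ (suc n) with q , q≥0 , e ← cardℚ n =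
  1ℚ ℚ.+ q , ℚ.nonNeg+nonNeg⇒nonNeg 1ℚ q {{q≥0}} , trans (+-congˡ e) (≗⇒≃ λ _ → ≡.refl)

card-invertible : ∀ n → ∃ λ r → card (suc n) · r ≃ 1ℝ
card-invertible n with q , q≥0 , e ← cardℚ n = fromℚ (ℚ.1/ (1ℚ ℚ.+ q)) , (begin
  (1ℝ + card n) · fromℚ (ℚ.1/ (1ℚ ℚ.+ q))   ≈⟨ ·-congʳ (+-congˡ e) ⟩
  (1ℝ + fromℚ q) · fromℚ (ℚ.1/ (1ℚ ℚ.+ q))  ≈⟨ ≗⇒≃ (λ _ → ℚ.*-inverseʳ (1ℚ ℚ.+ q)) ⟩
  1ℝ                                        ∎)
  where
  instance
    1+q≢0 : ℚ.NonZero (1ℚ ℚ.+ q)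
    1+q≢0 = ℚ.pos⇒nonZero (1ℚ ℚ.+ q) {{ℚ.pos+nonNeg⇒pos 1ℚ q {{q≥0}}}}

-- Spans

module _ {V : Module ℝ-commutativeRing 0ℓ 0ℓ} {⟨_,_⟩ : Module.Carrierᴹ V → Module.Carrierᴹ V → ℝ} where

  open Module V
  private
    module L = LinearAlgebra V ⟨_,_⟩
  open L using (Span)
  open L.IsSubspace

  linearCombination∈ : ∀ {W} → L.IsSubspace W → ∀ {m} (c : Fin m → ℝ) v →
    (∀ i → v i ∈ W) → L.linearCombination c v ∈ W
  linearCombination∈ W {zero}  c v v∈W = 0-closed W
  linearCombination∈ W {suc m} c v v∈W = +-closed W (*-closed W (c zero) (v∈W zero))
    (linearCombination∈ W (λ i → c (suc i)) (λ i → v (suc i)) (λ i → v∈W (suc i)))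

  Span-minimal : ∀ {S W} → L.IsSubspace W → S ⊆ W → Span S ⊆ W
  Span-minimal W S⊆W (_ , c , u , u∈S , v≈) =
    respects-≈ W (≈ᴹ-sym v≈) (linearCombination∈ W c u (λ i → S⊆W (u∈S i)))

  ∈-Span : ∀ {S} → S ⊆ Span S
  ∈-Span {S} {v} v∈S = 1 , (λ _ → 1ℝ) , (λ _ → v) , (λ _ → v∈S) ,
    ≈ᴹ-sym (≈ᴹ-trans (+ᴹ-identityʳ _) (*ₗ-identityˡ v))

  Span-isSubspace : ∀ S → L.IsSubspace (Span S)
  Span-isSubspace S = record
    { respects-≈ = λ { u≈v (m , c , w , w∈S , u≈) → m , c , w , w∈S , ≈ᴹ-trans (≈ᴹ-sym u≈v) u≈ }
    ; 0-closed   = 0 , (λ ()) , (λ ()) , (λ ()) , ≈ᴹ-refl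
    ; +-closed   = λ { (m , c , w , w∈S , u≈) v∈ → plus m c w w∈S u≈ v∈ }
    ; *-closed   = λ { a (m , c , w , w∈S , v≈) →
        m , (λ i → a · c i) , w , w∈S , ≈ᴹ-trans (*ₗ-congˡ v≈) (scale a m c w) }
    }
    where
    scale : ∀ a m c w → a *ₗ L.linearCombination {m} c w ≈ᴹ L.linearCombination (λ i → a · c i) w
    scale a zero    c w = *ₗ-zeroʳ a
    scale a (suc m) c w = ≈ᴹ-trans (*ₗ-distribˡ a _ _)
      (+ᴹ-cong (≈ᴹ-sym (*ₗ-assoc a _ _)) (scale a m (λ i → c (suc i)) (λ i → w (suc i))))

    -- Recursion on the first combination prepends its terms one at a time, so no index into a
    -- concatenation has to be split.
    plus : ∀ m c w → (∀ i → w i ∈ S) → ∀ {u v} → u ≈ᴹ L.linearCombination {m} c w →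
      v ∈ Span S → (u +ᴹ v) ∈ Span S
    plus zero c w w∈S u≈ (m , d , x , x∈S , v≈) =
      m , d , x , x∈S , ≈ᴹ-trans (+ᴹ-cong u≈ v≈) (+ᴹ-identityˡ _)
    plus (suc m) c w w∈S u≈ v∈
      with k , d , x , x∈S , e ← plus m (λ i → c (suc i)) (λ i → w (suc i)) (λ i → w∈S (suc i)) ≈ᴹ-refl v∈ =
      suc k , c zero Vector.∷ d , w zero Vector.∷ x , (λ { zero → w∈S zero ; (suc i) → x∈S i }) ,
      ≈ᴹ-trans (+ᴹ-congʳ u≈) (≈ᴹ-trans (+ᴹ-assoc _ _ _) (+ᴹ-congˡ e))

weight-linearCombination : ∀ {n m} (c : Fin m → ℝ) (v : Fin m → Graph n) p q →
  weight (linearCombination n c v) p q ≃ ∑[ i < m ] (c i · weight (v i) p q)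
weight-linearCombination {m = zero}  c v p q = refl
weight-linearCombination {m = suc m} c v p q =
  +-congˡ (weight-linearCombination (λ i → c (suc i)) (λ i → v (suc i)) p q)

-- Balanced graphs

rowSum : ∀ {n} → Graph n → Fin n → ℝ
rowSum {n} 𝒢 p = ∑[ q < n ] weight 𝒢 p q

rowSum-cong : ∀ {n} {𝒢 ℋ : Graph n} → 𝒢 ≈ᴳ ℋ → ∀ p → rowSum 𝒢 p ≃ rowSum ℋ p
rowSum-cong e p = sum-cong-≋ (weights-≃ e p)

rowSum-+ : ∀ {n} (𝒢 ℋ : Graph n) p → rowSum (𝒢 +ᴳ ℋ) p ≃ rowSum 𝒢 p + rowSum ℋ p
rowSum-+ 𝒢 ℋ p = ∑-distrib-+ (weight 𝒢 p) (weight ℋ p)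

rowSum-* : ∀ {n} c (𝒢 : Graph n) p → rowSum (c *ᴳ 𝒢) p ≃ c · rowSum 𝒢 p
rowSum-* c 𝒢 p = sym (*-distribˡ-sum c (weight 𝒢 p))

-- Reduces negation to scaling, so that row sums and subspaces inherit it from the scalar case.
-‿*ᴳ : ∀ {n} (𝒢 : Graph n) → (- 1ℝ) *ᴳ 𝒢 ≈ᴳ -ᴳ 𝒢
-‿*ᴳ 𝒢 = mk≈ᴳ λ i j → solve 1 (λ x → (:- con 1ℚ) :* x := :- x) refl (weight 𝒢 i j)

rowSum-neg : ∀ {n} (𝒢 : Graph n) p → rowSum (-ᴳ 𝒢) p ≃ - rowSum 𝒢 p
rowSum-neg 𝒢 p = begin
  rowSum (-ᴳ 𝒢) p            ≈⟨ rowSum-cong (-‿*ᴳ 𝒢) p ⟨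
  rowSum ((- 1ℝ) *ᴳ 𝒢) p     ≈⟨ rowSum-* (- 1ℝ) 𝒢 p ⟩
  - 1ℝ · rowSum 𝒢 p          ≈⟨ solve 1 (λ x → (:- con 1ℚ) :* x := :- x) refl (rowSum 𝒢 p) ⟩
  - rowSum 𝒢 p               ∎

Balanced : ∀ n → Pred (Graph n) 0ℓ
Balanced n 𝒢 = ∀ p → rowSum 𝒢 p ≃ 0ℝ

Balanced-isSubspace : ∀ n → IsSubspace n (Balanced n)
Balanced-isSubspace n = record
  { respects-≈ = λ u≈v u∈ p → trans (sym (rowSum-cong u≈v p)) (u∈ p)
  ; 0-closed   = λ p → sum-replicate-zero n
  ; +-closed   = λ {u} {v} u∈ v∈ p →
      trans (rowSum-+ u v p) (trans (+-cong (u∈ p) (v∈ p)) (+-identityˡ 0ℝ))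
  ; *-closed   = λ c {v} v∈ p → trans (rowSum-* c v p) (trans (·-congˡ (v∈ p)) (zeroʳ c))
  }

-ᴳ-closed : ∀ {n W} → IsSubspace n W → ∀ {𝒢} → 𝒢 ∈ W → -ᴳ 𝒢 ∈ W
-ᴳ-closed W {𝒢} 𝒢∈W = respects-≈ W (-‿*ᴳ 𝒢) (*-closed W (- 1ℝ) 𝒢∈W)
  where open IsSubspace

-- Closed path independent graphs

-- The factor 1 - δ clears the diagonal without a case distinction, so that `solve` applies. The
-- column comes first in `δ q p` because `sum-δ` sums over the first argument.
cpi : ∀ {n} → (Fin n → ℝ) → Graph n
weight    (cpi ω) p q = (1ℝ + - δ q p) · (ω p + ω q)
symmetric (cpi ω) p q = ·-cong (+-congˡ (-‿cong (δ-sym q p))) (+-comm (ω p) (ω q))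
loopless  (cpi ω) p   = begin
  (1ℝ + - δ p p) · (ω p + ω p) ≈⟨ ·-congʳ (+-congˡ (-‿cong (δ-≡ {p = p} ≡.refl))) ⟩
  (1ℝ + - 1ℝ) · (ω p + ω p)    ≈⟨ solve 1 (λ x → (con 1ℚ :+ :- con 1ℚ) :* (x :+ x) := con 0ℚ) refl (ω p) ⟩
  0ℝ                           ∎

cpi-≢ : ∀ {n} (ω : Fin n → ℝ) {p q} → p ≢ q → weight (cpi ω) p q ≃ ω p + ω q
cpi-≢ ω {p} {q} p≢q = begin
  (1ℝ + - δ q p) · (ω p + ω q) ≈⟨ ·-congʳ (+-congˡ (-‿cong (δ-≢ (p≢q ∘ ≡.sym)))) ⟩
  (1ℝ + - 0ℝ) · (ω p + ω q)    ≈⟨ solve 1 (λ x → (con 1ℚ :+ :- con 0ℚ) :* x := x) refl (ω p + ω q) ⟩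
  ω p + ω q                    ∎

cpi∈ℂℙ𝕀 : ∀ {n} (ω : Fin n → ℝ) → cpi ω ∈ ℂℙ𝕀 n
cpi∈ℂℙ𝕀 ω = ω , λ _ _ → cpi-≢ ω

-- `ℂℙ𝕀` constrains only the entries off the diagonal; on the diagonal both graphs vanish by
-- looplessness.
ℂℙ𝕀⇒cpi : ∀ {n} {𝒢 : Graph n} ((ω , _) : 𝒢 ∈ ℂℙ𝕀 n) → 𝒢 ≈ᴳ cpi ω
ℂℙ𝕀⇒cpi {𝒢 = 𝒢} (ω , e) = mk≈ᴳ entry
  where
  entry : ∀ p q → weight 𝒢 p q ≃ weight (cpi ω) p q
  entry p q with p ≟ q
  ... | yes ≡.refl = trans (loopless 𝒢 p) (sym (loopless (cpi ω) p))
  ... | no  p≢q    = trans (e p q p≢q) (sym (cpi-≢ ω p≢q))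

cpi-cong : ∀ {n} {ω ψ : Fin n → ℝ} → (∀ i → ω i ≃ ψ i) → cpi ω ≈ᴳ cpi ψ
cpi-cong e = mk≈ᴳ λ p q → ·-congˡ (+-cong (e p) (e q))

cpi-0 : ∀ {n} → cpi {n} (λ _ → 0ℝ) ≈ᴳ 0ᴳ
cpi-0 = mk≈ᴳ λ p q → solve 1 (λ x → x :* (con 0ℚ :+ con 0ℚ) := con 0ℚ) refl (1ℝ + - δ q p)

ℂℙ𝕀-isSubspace : ∀ n → IsSubspace n (ℂℙ𝕀 n)
ℂℙ𝕀-isSubspace n = record
  { respects-≈ = λ { u≈v (ω , e) → ω , λ j k j≢k → trans (sym (weights-≃ u≈v j k)) (e j k j≢k) }
  ; 0-closed   = (λ _ → 0ℝ) , λ _ _ _ → sym (+-identityˡ 0ℝ)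
  ; +-closed   = λ { (ω , e) (ψ , f) → (λ i → ω i + ψ i) , λ j k j≢k → trans
      (+-cong (e j k j≢k) (f j k j≢k))
      (solve 4 (λ a b c d → (a :+ b) :+ (c :+ d) := (a :+ c) :+ (b :+ d)) refl (ω j) (ω k) (ψ j) (ψ k)) }
  ; *-closed   = λ { c (ω , e) → (λ i → c · ω i) , λ j k j≢k → trans
      (·-congˡ (e j k j≢k)) (ℝ-Ring.distribˡ c (ω j) (ω k)) }
  }

-- Over all n columns ω p + ω q sums to n ω p + ∑ ω; the excluded column q = p takes away 2 ω p, and
-- n - 2 is `k`.
rowSum-cpi : ∀ {k} (ω : Fin (suc (suc k)) → ℝ) p → rowSum (cpi ω) p ≃ card k · ω p + sum ω
rowSum-cpi {k} ω p = begin
  ∑[ q < n ] ((1ℝ + - δ q p) · (ω p + ω q))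
    ≈⟨ sum-cong-≋ (λ q → solve 3 (λ d x y → (con 1ℚ :+ :- d) :* (x :+ y) := (x :+ y) :+ d :* (:- (x :+ y)))
         refl (δ q p) (ω p) (ω q)) ⟩
  ∑[ q < n ] ((ω p + ω q) + δ q p · - (ω p + ω q))
    ≈⟨ ∑-distrib-+ (λ q → ω p + ω q) (λ q → δ q p · - (ω p + ω q)) ⟩
  ∑[ q < n ] (ω p + ω q) + ∑[ q < n ] (δ q p · - (ω p + ω q))
    ≈⟨ +-cong (∑-distrib-+ (λ _ → ω p) ω) (sum-δ (λ q → - (ω p + ω q)) p) ⟩
  (∑[ _ < n ] (ω p) + sum ω) + - (ω p + ω p)
    ≈⟨ +-congʳ (+-congʳ (sum-const n (ω p))) ⟩
  (card n · ω p + sum ω) + - (ω p + ω p)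
    ≈⟨ solve 3 (λ K x S → ((con 1ℚ :+ (con 1ℚ :+ K)) :* x :+ S) :+ :- (x :+ x) := K :* x :+ S)
         refl (card k) (ω p) (sum ω) ⟩
  card k · ω p + sum ω ∎
  where
  n = suc (suc k)

-- With K = n - 2, summing K ω p + ∑ ω = 0 over p gives 2 (K + 1) ∑ ω = 0.
balanced-cpi⇒0 : ∀ {m} (ω : Fin (3 ℕ.+ m) → ℝ) → cpi ω ∈ Balanced (3 ℕ.+ m) → ∀ p → ω p ≃ 0ℝ
balanced-cpi⇒0 {m} ω bal = ω≃0
  where
  n = 3 ℕ.+ m
  K = card (1 ℕ.+ m)
  S = sum ω
  -- `t` inverts `K`, which is n - 2, and `s` inverts `1ℝ + K`, which is n - 1.
  t = proj₁ (card-invertible m)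
  s = proj₁ (card-invertible (suc m))

  equation : ∀ p → K · ω p + S ≃ 0ℝ
  equation p = trans (sym (rowSum-cpi ω p)) (bal p)

  S≃0 : S ≃ 0ℝ
  S≃0 = begin
    S                                        ≈⟨ ·-identityˡ S ⟨
    1ℝ · S                                   ≈⟨ ·-congʳ (proj₂ (card-invertible (suc m))) ⟨
    ((1ℝ + K) · s) · S
      -- K + (2 + K) is twice 1 + K, whence the factor ½.
      ≈⟨ solve 3 (λ K s S → ((con 1ℚ :+ K) :* s) :* S := (con ½ :* s) :* (K :* S :+ (con 1ℚ :+ (con 1ℚ :+ K)) :* S))
           refl K s S ⟩
    (fromℚ ½ · s) · (K · S + card n · S)     ≈⟨ ·-congˡ (+-cong (*-distribˡ-sum K ω) (sym (sum-const n S))) ⟩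
    (fromℚ ½ · s) · (∑[ p < n ] (K · ω p) + ∑[ p < n ] S)
                                             ≈⟨ ·-congˡ (∑-distrib-+ (λ p → K · ω p) (λ _ → S)) ⟨
    (fromℚ ½ · s) · ∑[ p < n ] (K · ω p + S) ≈⟨ ·-congˡ (sum-zero equation) ⟩
    (fromℚ ½ · s) · 0ℝ                       ≈⟨ zeroʳ (fromℚ ½ · s) ⟩
    0ℝ                                       ∎

  ω≃0 : ∀ p → ω p ≃ 0ℝ
  ω≃0 p = begin
    ω p                        ≈⟨ ·-identityˡ (ω p) ⟨
    1ℝ · ω p                   ≈⟨ ·-congʳ (proj₂ (card-invertible m)) ⟨
    (K · t) · ω p              ≈⟨ solve 4 (λ K t x S → (K :* t) :* x := t :* ((K :* x :+ S) :+ :- S)) refl K t (ω p) S ⟩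
    t · ((K · ω p + S) + - S)  ≈⟨ ·-congˡ (+-cong (equation p) (-‿cong S≃0)) ⟩
    t · (0ℝ + - 0ℝ)            ≈⟨ solve 1 (λ t → t :* (con 0ℚ :+ :- con 0ℚ) := con 0ℚ) refl t ⟩
    0ℝ                         ∎

ℂℙ𝕀∩Balanced : ∀ {m} {𝒢 : Graph (3 ℕ.+ m)} → 𝒢 ∈ ℂℙ𝕀 (3 ℕ.+ m) → 𝒢 ∈ Balanced (3 ℕ.+ m) → 𝒢 ≈ᴳ 0ᴳ
ℂℙ𝕀∩Balanced {m} {𝒢} 𝒢∈@(ω , _) bal = mk≈ᴳ λ p q → begin
  weight 𝒢 p q              ≈⟨ weights-≃ 𝒢≈ p q ⟩
  weight (cpi ω) p q        ≈⟨ weights-≃ (cpi-cong (balanced-cpi⇒0 ω bal′)) p q ⟩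
  weight (cpi (λ _ → 0ℝ)) p q ≈⟨ weights-≃ cpi-0 p q ⟩
  0ℝ                        ∎
  where
  𝒢≈ : 𝒢 ≈ᴳ cpi ω
  𝒢≈ = ℂℙ𝕀⇒cpi {𝒢 = 𝒢} 𝒢∈

  bal′ : cpi ω ∈ Balanced (3 ℕ.+ m)
  bal′ = IsSubspace.respects-≈ (Balanced-isSubspace (3 ℕ.+ m)) 𝒢≈ bal

-- The system is K ω p + ∑ ω = r p with K = n - 2. Summing over p forces ∑ ω = ∑ r / (2 (n - 1)),
-- the value `u`; then ω p = (r p - u) / K, and `sum-ω` confirms that this ω really has sum `u`.
cpi-with-rowSums : ∀ {m} (r : Fin (3 ℕ.+ m) → ℝ) → ∃ λ ω → ∀ p → rowSum (cpi ω) p ≃ r p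
cpi-with-rowSums {m} r = ω , λ p → begin
  rowSum (cpi ω) p                 ≈⟨ rowSum-cpi ω p ⟩
  K · (t · (r p + - u)) + sum ω    ≈⟨ +-congˡ sum-ω ⟩
  K · (t · (r p + - u)) + u        ≈⟨ solve 4 (λ K t r u → K :* (t :* (r :+ :- u)) :+ u := (K :* t) :* (r :+ :- u) :+ u) refl K t (r p) u ⟩
  (K · t) · (r p + - u) + u        ≈⟨ +-congʳ (·-congʳ (proj₂ (card-invertible m))) ⟩
  1ℝ · (r p + - u) + u             ≈⟨ solve 2 (λ r u → con 1ℚ :* (r :+ :- u) :+ u := r) refl (r p) u ⟩
  r p                              ∎
  where
  n = 3 ℕ.+ m
  K = card (1 ℕ.+ m)
  t = proj₁ (card-invertible m)
  s = proj₁ (card-invertible (suc m))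
  T = sum r
  u = fromℚ ½ · s · T
  ω : Fin n → ℝ
  ω p = t · (r p + - u)

  sum-ω : sum ω ≃ u
  sum-ω = begin
    sum ω                                ≈⟨ *-distribˡ-sum t (λ p → r p + - u) ⟨
    t · ∑[ p < n ] (r p + - u)           ≈⟨ ·-congˡ (∑-distrib-+ r (λ _ → - u)) ⟩
    t · (T + ∑[ p < n ] (- u))           ≈⟨ ·-congˡ (+-cong (sym (·-identityˡ T)) (sum-const n (- u))) ⟩
    t · (1ℝ · T + card n · - u)          ≈⟨ ·-congˡ (+-congʳ (·-congʳ (proj₂ (card-invertible (suc m))))) ⟨
    t · (((1ℝ + K) · s) · T + card n · - u)
      ≈⟨ solve 4 (λ K t s T → t :* (((con 1ℚ :+ K) :* s) :* T :+ (con 1ℚ :+ (con 1ℚ :+ K)) :* (:- (con ½ :* s :* T)))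
                           := (K :* t) :* (con ½ :* s :* T)) refl K t s T ⟩
    (K · t) · u                          ≈⟨ ·-congʳ (proj₂ (card-invertible m)) ⟩
    1ℝ · u                               ≈⟨ ·-identityˡ u ⟩
    u                                    ∎

-- `cpi` is linear and c = ∑ c i δ i. The basis graph `cpi (δ i)` is the star at i: weight 1 on the
-- edges at i, 0 elsewhere.
linearCombination-cpi-δ : ∀ {n} (c : Fin n → ℝ) →
  linearCombination n c (λ i → cpi (δ i)) ≈ᴳ cpi c
linearCombination-cpi-δ {n} c = mk≈ᴳ λ p q → begin
  weight (linearCombination n c (λ i → cpi (δ i))) p q
    ≈⟨ weight-linearCombination c (λ i → cpi (δ i)) p q ⟩
  ∑[ i < n ] (c i · ((1ℝ + - δ q p) · (δ i p + δ i q)))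
    ≈⟨ sum-cong-≋ (λ i → solve 4 (λ c e x y → c :* (e :* (x :+ y)) := e :* (x :* c :+ y :* c))
         refl (c i) (1ℝ + - δ q p) (δ i p) (δ i q)) ⟩
  ∑[ i < n ] ((1ℝ + - δ q p) · (δ i p · c i + δ i q · c i))
    ≈⟨ *-distribˡ-sum (1ℝ + - δ q p) (λ i → δ i p · c i + δ i q · c i) ⟨
  (1ℝ + - δ q p) · ∑[ i < n ] (δ i p · c i + δ i q · c i)
    ≈⟨ ·-congˡ (∑-distrib-+ (λ i → δ i p · c i) (λ i → δ i q · c i)) ⟩
  (1ℝ + - δ q p) · (∑[ i < n ] (δ i p · c i) + ∑[ i < n ] (δ i q · c i))
    ≈⟨ ·-congˡ (+-cong (sum-δ c p) (sum-δ c q)) ⟩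
  (1ℝ + - δ q p) · (c p + c q) ∎

ℂℙ𝕀-dimension : ∀ m → HasDimension (3 ℕ.+ m) (ℂℙ𝕀 (3 ℕ.+ m)) (3 ℕ.+ m)
ℂℙ𝕀-dimension m = (λ i → cpi (δ i)) , record
  { contained   = λ i → cpi∈ℂℙ𝕀 (δ i)
  -- A vanishing combination makes `cpi c` equal to the zero graph, which is balanced.
  ; independent = λ c e → balanced-cpi⇒0 c
      (respects-≈ (≈ᴹ-trans (≈ᴹ-sym e) (linearCombination-cpi-δ c)) 0-closed)
  ; spanning    = λ { w w∈@(ω , _) → ω , ≈ᴹ-trans (ℂℙ𝕀⇒cpi w∈) (≈ᴹ-sym (linearCombination-cpi-δ ω)) }
  }
  where
  open IsSubspace (3 ℕ.+ m) (Balanced-isSubspace (3 ℕ.+ m)) using (respects-≈; 0-closed)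
  open Module (𝔾 (3 ℕ.+ m)) using (≈ᴹ-sym; ≈ᴹ-trans)

-- Orthogonality

⟨⟩ᴳ-comm : ∀ {n} (𝒢 ℋ : Graph n) → ⟨ 𝒢 , ℋ ⟩ᴳ ≃ ⟨ ℋ , 𝒢 ⟩ᴳ
⟨⟩ᴳ-comm 𝒢 ℋ = sum-cong-≋ λ i → sum-cong-≋ λ j → entry i j
  where
  entry : ∀ i j → (if does (i <? j) then weight 𝒢 i j · weight ℋ i j else 0ℝ)
                ≃ (if does (i <? j) then weight ℋ i j · weight 𝒢 i j else 0ℝ)
  entry i j with does (i <? j)
  ... | true  = ·-comm _ _
  ... | false = refl

-- Summing (ω i + ω j) h i j over i < j gives ∑ ω i h i j over all ordered pairs, i.e. ∑ ω i · rowSum i.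
ℂℙ𝕀⟂Balanced : ∀ {n} {𝒢 ℋ : Graph n} → 𝒢 ∈ ℂℙ𝕀 n → ℋ ∈ Balanced n → ⟨ 𝒢 , ℋ ⟩ᴳ ≃ 0ℝ
ℂℙ𝕀⟂Balanced {n} {𝒢} {ℋ} (ω , e) bal = begin
  ⟨ 𝒢 , ℋ ⟩ᴳ
    ≈⟨ (sum-cong-≋ λ i → sum-cong-≋ λ j → split i j) ⟩
  ∑[ i < n ] ∑[ j < n ] (upper i j + upper′ i j)
    ≈⟨ (sum-cong-≋ λ i → ∑-distrib-+ (upper i) (upper′ i)) ⟩
  ∑[ i < n ] (sum (upper i) + sum (upper′ i))
    ≈⟨ ∑-distrib-+ (λ i → sum (upper i)) (λ i → sum (upper′ i)) ⟩
  ∑[ i < n ] sum (upper i) + ∑[ i < n ] sum (upper′ i)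
    -- Exchanging the indices turns the terms with ω j over i < j into terms with ω i over j < i,
    -- the missing half of row i.
    ≈⟨ +-congˡ (∑-comm upper′) ⟩
  ∑[ i < n ] sum (upper i) + ∑[ i < n ] ∑[ j < n ] upper′ j i
    ≈⟨ ∑-distrib-+ (λ i → sum (upper i)) (λ i → ∑[ j < n ] upper′ j i) ⟨
  ∑[ i < n ] (sum (upper i) + ∑[ j < n ] upper′ j i)
    ≈⟨ (sum-cong-≋ λ i → ∑-distrib-+ (upper i) (λ j → upper′ j i)) ⟨
  ∑[ i < n ] ∑[ j < n ] (upper i j + upper′ j i)
    ≈⟨ (sum-cong-≋ λ i → sum-cong-≋ λ j → merge i j) ⟩
  ∑[ i < n ] ∑[ j < n ] (ω i · weight ℋ i j)
    ≈⟨ (sum-cong-≋ λ i → *-distribˡ-sum (ω i) (weight ℋ i)) ⟨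
  ∑[ i < n ] (ω i · rowSum ℋ i)
    ≈⟨ (sum-zero λ i → trans (·-congˡ (bal i)) (zeroʳ (ω i))) ⟩
  0ℝ ∎
  where
  upper upper′ : Fin n → Fin n → ℝ
  upper  i j = if does (i <? j) then ω i · weight ℋ i j else 0ℝ
  upper′ i j = if does (i <? j) then ω j · weight ℋ i j else 0ℝ

  split : ∀ i j → (if does (i <? j) then weight 𝒢 i j · weight ℋ i j else 0ℝ) ≃ upper i j + upper′ i j
  split i j with i <? j
  ... | yes i<j rewrite dec-true (i <? j) i<j =
    trans (·-congʳ (e i j (<⇒≢ i<j))) (ℝ-Ring.distribʳ (weight ℋ i j) (ω i) (ω j))
  ... | no  i≮j rewrite dec-false (i <? j) i≮j = sym (+-identityˡ 0ℝ)

  merge : ∀ i j → upper i j + upper′ j i ≃ ω i · weight ℋ i j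
  merge i j with <-cmp i j
  ... | tri< i<j _ j≮i rewrite dec-true (i <? j) i<j | dec-false (j <? i) j≮i = +-identityʳ _
  ... | tri> i≮j _ j<i rewrite dec-false (i <? j) i≮j | dec-true (j <? i) j<i =
    trans (+-identityˡ _) (·-congˡ (symmetric ℋ j i))
  ... | tri≈ i≮i ≡.refl _ rewrite dec-false (i <? i) i≮i = begin
    0ℝ + 0ℝ            ≈⟨ +-identityˡ 0ℝ ⟩
    0ℝ                 ≈⟨ zeroʳ (ω i) ⟨
    ω i · 0ℝ           ≈⟨ ·-congˡ (loopless ℋ i) ⟨
    ω i · weight ℋ i i ∎

-- Cycles

-- A polynomial in `δ` instead of a case distinction, so that the solver can treat it. For i = j it
-- would put 2 on the diagonal; hence `edge` asks for i ≢ j.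
E : ∀ {n} (i j p q : Fin n) → ℝ
E i j p q = δ p i · δ q j + δ p j · δ q i

E-swap : ∀ {n} (i j p q : Fin n) → E i j p q ≃ E j i p q
E-swap i j p q = +-comm _ _

δδ≃0 : ∀ {n} {i j p q : Fin n} → ¬ (p ≡ i × q ≡ j) → δ p i · δ q j ≃ 0ℝ
δδ≃0 {i = i} {j} {p} {q} ¬pq with p ≟ i
... | no  p≢i = zeroˡ _
... | yes p≡i = trans (·-congˡ (δ-≢ λ q≡j → ¬pq (p≡i , q≡j))) (zeroʳ _)

E-0 : ∀ {n} (i j p q : Fin n) → ¬ SameEdge i j p q → E i j p q ≃ 0ℝ
E-0 i j p q ¬same = trans (+-cong (δδ≃0 (¬same ∘ inj₁)) (δδ≃0 (¬same ∘ inj₂))) (+-identityˡ 0ℝ)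

E-1 : ∀ {n} {i j : Fin n} → i ≢ j → E i j i j ≃ 1ℝ
E-1 {i = i} {j} i≢j = begin
  δ i i · δ j j + δ i j · δ j i ≈⟨ +-cong (·-cong (δ-≡ {p = i} ≡.refl) (δ-≡ {p = j} ≡.refl)) (·-congʳ (δ-≢ i≢j)) ⟩
  1ℝ · 1ℝ + 0ℝ · δ j i          ≈⟨ solve 1 (λ x → con 1ℚ :* con 1ℚ :+ con 0ℚ :* x := con 1ℚ) refl (δ j i) ⟩
  1ℝ                            ∎

edge : ∀ {n} (i j : Fin n) → i ≢ j → Graph n
weight    (edge i j i≢j) = E i j
symmetric (edge i j i≢j) p q = solve 4 (λ a b c d → a :* b :+ c :* d := d :* c :+ b :* a)
  refl (δ p i) (δ q j) (δ p j) (δ q i)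
loopless  (edge i j i≢j) p   = E-0 i j p p λ
  { (inj₁ (≡.refl , p≡j)) → i≢j p≡j
  ; (inj₂ (≡.refl , p≡i)) → i≢j (≡.sym p≡i) }

rowSum-edge : ∀ {n} {i j : Fin n} (i≢j : i ≢ j) p → rowSum (edge i j i≢j) p ≃ δ p i + δ p j
rowSum-edge {n} {i} {j} i≢j p = begin
  ∑[ q < n ] (δ p i · δ q j + δ p j · δ q i)
    ≈⟨ (sum-cong-≋ λ q → solve 4 (λ a b c d → a :* b :+ c :* d := b :* a :+ d :* c)
         refl (δ p i) (δ q j) (δ p j) (δ q i)) ⟩
  ∑[ q < n ] (δ q j · δ p i + δ q i · δ p j)
    ≈⟨ ∑-distrib-+ (λ q → δ q j · δ p i) (λ q → δ q i · δ p j) ⟩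
  ∑[ q < n ] (δ q j · δ p i) + ∑[ q < n ] (δ q i · δ p j)
    ≈⟨ +-cong (sum-δ (λ _ → δ p i) j) (sum-δ (λ _ → δ p j) i) ⟩
  δ p i + δ p j ∎

sameEdge? : ∀ {n} (i j p q : Fin n) → Dec (SameEdge i j p q)
sameEdge? i j p q = (p ≟ i ×-dec q ≟ j) ⊎-dec (p ≟ j ×-dec q ≟ i)

SameEdge⇒≃ : ∀ {n} (𝒢 : Graph n) {i j p q} → SameEdge i j p q → weight 𝒢 p q ≃ weight 𝒢 i j
SameEdge⇒≃ 𝒢 (inj₁ (≡.refl , ≡.refl)) = refl
SameEdge⇒≃ 𝒢 (inj₂ (≡.refl , ≡.refl)) = symmetric 𝒢 _ _

-- Every entry lies on one of the four edges or on none, and each case prescribes its value.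
-- Properties of the generators of `ℂ` can therefore be checked on the explicit graph `𝐛`.
Is-𝐛-unique : ∀ {n} {i j k s : Fin n} {𝒢 ℋ} → Is-𝐛 i j k s 𝒢 → Is-𝐛 i j k s ℋ → 𝒢 ≈ᴳ ℋ
Is-𝐛-unique {i = i} {j} {k} {s} {𝒢} {ℋ} b b′ = mk≈ᴳ entry
  where
  open Is-𝐛
  agree : ∀ {i j p q x} → SameEdge i j p q → weight 𝒢 i j ≃ x → weight ℋ i j ≃ x →
    weight 𝒢 p q ≃ weight ℋ p q
  agree same e f = trans (SameEdge⇒≃ 𝒢 same) (trans e (trans (sym f) (sym (SameEdge⇒≃ ℋ same))))

  entry : ∀ p q → weight 𝒢 p q ≃ weight ℋ p q
  entry p q with sameEdge? i j p q | sameEdge? j k p q | sameEdge? k s p q | sameEdge? s i p q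
  ... | yes same | _ | _ | _ = agree same (d-ij b) (d-ij b′)
  ... | no _ | yes same | _ | _ = agree same (d-jk b) (d-jk b′)
  ... | no _ | no _ | yes same | _ = agree same (d-ks b) (d-ks b′)
  ... | no _ | no _ | no _ | yes same = agree same (d-si b) (d-si b′)
  ... | no ¬ij | no ¬jk | no ¬ks | no ¬si =
    trans (d-other b p q ¬ij ¬jk ¬ks ¬si) (sym (d-other b′ p q ¬ij ¬jk ¬ks ¬si))

𝐛 : ∀ {n} (i j k s : Fin n) → Unique (i ∷ j ∷ k ∷ s ∷ []) → Graph n
𝐛 i j k s ((i≢j ∷ i≢k ∷ i≢s ∷ []) ∷ (j≢k ∷ j≢s ∷ []) ∷ (k≢s ∷ []) ∷ [] ∷ []) =
  edge i j i≢j +ᴳ -ᴳ edge j k j≢k +ᴳ edge k s k≢s +ᴳ -ᴳ edge s i (≢-sym i≢s)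

-- The four edges are distinct because one endpoint of each avoids any other. So `combine` replaces
-- every term by the constant 0 or 1, and the closed expression left over evaluates in `ℚ`.
𝐛-Is-𝐛 : ∀ {n} {i j k s : Fin n} (u : Unique (i ∷ j ∷ k ∷ s ∷ [])) → Is-𝐛 i j k s (𝐛 i j k s u)
𝐛-Is-𝐛 {i = i} {j} {k} {s} u@((i≢j ∷ i≢k ∷ i≢s ∷ []) ∷ (j≢k ∷ j≢s ∷ []) ∷ (k≢s ∷ []) ∷ [] ∷ []) = record
  { distinct = u
  ; d-ij     = trans
      (combine (E-1 i≢j) (E-0 j k i j (apartˡ i≢j i≢k)) (E-0 k s i j (apartˡ i≢k i≢s)) (E-0 s i i j (apartʳ j≢s (≢-sym i≢j))))
      (≗⇒≃ λ _ → ≡.refl)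
  ; d-jk     = trans
      (combine (E-0 i j j k (apartʳ (≢-sym i≢k) (≢-sym j≢k))) (E-1 j≢k) (E-0 k s j k (apartˡ j≢k j≢s)) (E-0 s i j k (apartˡ j≢s (≢-sym i≢j))))
      (≗⇒≃ λ _ → ≡.refl)
  ; d-ks     = trans
      (combine (E-0 i j k s (apartˡ (≢-sym i≢k) (≢-sym j≢k))) (E-0 j k k s (apartʳ (≢-sym j≢s) (≢-sym k≢s))) (E-1 k≢s) (E-0 s i k s (apartˡ k≢s (≢-sym i≢k))))
      (≗⇒≃ λ _ → ≡.refl)
  ; d-si     = trans
      (combine (E-0 i j s i (apartˡ (≢-sym i≢s) (≢-sym j≢s))) (E-0 j k s i (apartˡ (≢-sym j≢s) (≢-sym k≢s))) (E-0 k s s i (apartʳ i≢k i≢s)) (E-1 (≢-sym i≢s)))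
      (≗⇒≃ λ _ → ≡.refl)
  ; d-other  = λ p q ¬ij ¬jk ¬ks ¬si → trans
      (combine (E-0 i j p q ¬ij) (E-0 j k p q ¬jk) (E-0 k s p q ¬ks) (E-0 s i p q ¬si))
      (≗⇒≃ λ _ → ≡.refl)
  }
  where
  apartˡ : ∀ {a b p q : Fin _} → p ≢ a → p ≢ b → ¬ SameEdge a b p q
  apartˡ p≢a p≢b (inj₁ (p≡a , _)) = p≢a p≡a
  apartˡ p≢a p≢b (inj₂ (p≡b , _)) = p≢b p≡b

  apartʳ : ∀ {a b p q : Fin _} → q ≢ a → q ≢ b → ¬ SameEdge a b p q
  apartʳ q≢a q≢b (inj₁ (_ , q≡b)) = q≢b q≡b
  apartʳ q≢a q≢b (inj₂ (_ , q≡a)) = q≢a q≡a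

  combine : ∀ {x x′ y y′ z z′ w w′} → x ≃ x′ → y ≃ y′ → z ≃ z′ → w ≃ w′ →
    x + - y + z + - w ≃ x′ + - y′ + z′ + - w′
  combine e f g h = +-cong (+-cong (+-cong e (-‿cong f)) g) (-‿cong h)

Is-cycle : ∀ n → Pred (Graph n) 0ℓ
Is-cycle n 𝒢 = ∃ λ i → ∃ λ j → ∃ λ k → ∃ λ s → Is-𝐛 i j k s 𝒢

𝐛∈ℂ : ∀ {n} {i j k s : Fin n} (u : Unique (i ∷ j ∷ k ∷ s ∷ [])) → 𝐛 i j k s u ∈ ℂ n
𝐛∈ℂ {n} u = ∈-Span {V = 𝔾 n} {⟨_,_⟩ᴳ} {Is-cycle n} (_ , _ , _ , _ , 𝐛-Is-𝐛 u)

-- Each vertex of the cycle lies on two consecutive edges, which carry opposite signs.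
𝐛-balanced : ∀ {n} {i j k s : Fin n} (u : Unique (i ∷ j ∷ k ∷ s ∷ [])) → 𝐛 i j k s u ∈ Balanced n
𝐛-balanced {i = i} {j} {k} {s} u@((i≢j ∷ i≢k ∷ i≢s ∷ []) ∷ (j≢k ∷ j≢s ∷ []) ∷ (k≢s ∷ []) ∷ [] ∷ []) p = begin
  rowSum (𝐛 i j k s u) p
    ≈⟨ rowSum-+ (ij +ᴳ -ᴳ jk +ᴳ ks) (-ᴳ si) p ⟩
  rowSum (ij +ᴳ -ᴳ jk +ᴳ ks) p + rowSum (-ᴳ si) p
    ≈⟨ +-cong (rowSum-+ (ij +ᴳ -ᴳ jk) ks p) (rowSum-neg si p) ⟩
  rowSum (ij +ᴳ -ᴳ jk) p + rowSum ks p + - rowSum si p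
    ≈⟨ +-congʳ (+-congʳ (trans (rowSum-+ ij (-ᴳ jk) p) (+-congˡ (rowSum-neg jk p)))) ⟩
  rowSum ij p + - rowSum jk p + rowSum ks p + - rowSum si p
    ≈⟨ +-cong (+-cong (+-cong (rowSum-edge i≢j p) (-‿cong (rowSum-edge j≢k p))) (rowSum-edge k≢s p))
         (-‿cong (rowSum-edge (≢-sym i≢s) p)) ⟩
  (δ p i + δ p j) + - (δ p j + δ p k) + (δ p k + δ p s) + - (δ p s + δ p i)
    ≈⟨ solve 4 (λ i j k s → (i :+ j) :+ :- (j :+ k) :+ (k :+ s) :+ :- (s :+ i) := con 0ℚ)
         refl (δ p i) (δ p j) (δ p k) (δ p s) ⟩
  0ℝ ∎
  where
  ij = edge i j i≢j
  jk = edge j k j≢k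
  ks = edge k s k≢s
  si = edge s i (≢-sym i≢s)

ℂ-isSubspace : ∀ n → IsSubspace n (ℂ n)
ℂ-isSubspace n = Span-isSubspace (Is-cycle n)

ℂ⊆Balanced : ∀ {n} {𝒢 : Graph n} → 𝒢 ∈ ℂ n → 𝒢 ∈ Balanced n
ℂ⊆Balanced {n} {𝒢} = Span-minimal (Balanced-isSubspace n) (λ {ℋ} → generator {ℋ}) {𝒢}
  where
  open IsSubspace
  open Is-𝐛
  generator : ∀ {ℋ} → ℋ ∈ Is-cycle n → ℋ ∈ Balanced n
  generator (_ , _ , _ , _ , b) = respects-≈ (Balanced-isSubspace n)
    (Is-𝐛-unique (𝐛-Is-𝐛 (distinct b)) b) (𝐛-balanced (distinct b))

-- Its row sums vanish except at vertex 0, where the row sum is -2 whatever a and b are; differences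
-- of triangles are thus balanced.
triangle : ∀ {k} (a b : Fin k) → a ≢ b → Graph (suc k)
triangle a b a≢b =
  edge (suc a) (suc b) (a≢b ∘ suc-injective) +ᴳ -ᴳ edge zero (suc a) (λ ()) +ᴳ -ᴳ edge zero (suc b) (λ ())

triangle-swap : ∀ {k} {a b : Fin k} (a≢b : a ≢ b) (b≢a : b ≢ a) → triangle a b a≢b ≈ᴳ triangle b a b≢a
triangle-swap {a = a} {b} a≢b b≢a = mk≈ᴳ λ p q → trans
  (+-congʳ (+-congʳ (E-swap (suc a) (suc b) p q)))
  (solve 3 (λ x y z → x :+ :- y :+ :- z := x :+ :- z :+ :- y) refl
    (E (suc b) (suc a) p q) (E zero (suc a) p q) (E zero (suc b) p q))

-- The common edge from 0 to `suc a` cancels, and what remains is the 4-cycle through `suc a`,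
-- `suc b`, `zero`, `suc c`.
triangle-difference∈ℂ : ∀ {k} {a b c : Fin k} (a≢b : a ≢ b) (a≢c : a ≢ c) → b ≢ c →
  triangle a b a≢b +ᴳ -ᴳ triangle a c a≢c ∈ ℂ (suc k)
triangle-difference∈ℂ {k} {a} {b} {c} a≢b a≢c b≢c = IsSubspace.respects-≈ (ℂ-isSubspace (suc k))
  (mk≈ᴳ λ p q → trans
    (+-cong (+-congʳ (+-congˡ (-‿cong (E-swap (suc b) zero p q)))) (-‿cong (E-swap (suc c) (suc a) p q)))
    (solve 5 (λ ab b0 c0 ac a0 → ab :+ :- b0 :+ c0 :+ :- ac
                              := (ab :+ :- a0 :+ :- b0) :+ :- (ac :+ :- a0 :+ :- c0)) refl
      (E (suc a) (suc b) p q) (E zero (suc b) p q) (E zero (suc c) p q) (E (suc a) (suc c) p q) (E zero (suc a) p q)))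
  (𝐛∈ℂ {i = suc a} {suc b} {zero} {suc c}
    (((a≢b ∘ suc-injective) ∷ (λ ()) ∷ (a≢c ∘ suc-injective) ∷ [])
      ∷ ((λ ()) ∷ (b≢c ∘ suc-injective) ∷ []) ∷ ((λ ()) ∷ []) ∷ [] ∷ []))

chordGraph : ∀ {m} (a b : Fin (2 ℕ.+ m)) → a ≢ b → Graph (3 ℕ.+ m)
chordGraph a b a≢b = triangle a b a≢b +ᴳ -ᴳ triangle zero (suc zero) (λ ())

-- If a is `zero`, the two triangles share an index. Otherwise the triangle on `zero` and b is
-- inserted between them, and each of the two resulting differences shares an index.
chordGraph∈ℂ : ∀ {m} {a b : Fin (2 ℕ.+ m)} (a≢b : a ≢ b) → b ≢ zero → b ≢ suc zero →
  chordGraph a b a≢b ∈ ℂ (3 ℕ.+ m)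
chordGraph∈ℂ {m} {zero}  {b} a≢b b≢0 b≢1 = triangle-difference∈ℂ a≢b (λ ()) b≢1
chordGraph∈ℂ {m} {suc a} {b} a≢b b≢0 b≢1 = respects-≈ 𝒮
  (mk≈ᴳ λ p q → trans
    (+-congʳ (+-cong (weights-≃ (triangle-swap (≢-sym a≢b) a≢b) p q)
                     (-‿cong (weights-≃ (triangle-swap b≢0 (≢-sym b≢0)) p q))))
    (solve 3 (λ x y z → (x :+ :- y) :+ (y :+ :- z) := x :+ :- z) refl
      (weight (triangle (suc a) b a≢b) p q) (weight (triangle zero b (≢-sym b≢0)) p q)
      (weight (triangle {2 ℕ.+ m} zero (suc zero) λ ()) p q)))
  (+-closed 𝒮 (triangle-difference∈ℂ (≢-sym a≢b) b≢0 λ ())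
              (triangle-difference∈ℂ (≢-sym b≢0) (λ ()) b≢1))
  where
  open IsSubspace
  𝒮 = ℂ-isSubspace (3 ℕ.+ m)

-- The edges at vertex 0 contribute nothing: `δ` of a successor and `zero` computes to `0ℝ`, and `δ`
-- of two successors to `δ` of their predecessors, so the solver sees both.
weight-triangle : ∀ {k} {a b : Fin k} (a≢b : a ≢ b) p q →
  weight (triangle a b a≢b) (suc p) (suc q) ≃ E a b p q
weight-triangle {a = a} {b} a≢b p q = solve 5
  (λ x pa pb qa qb → x :+ :- (con 0ℚ :* qa :+ pa :* con 0ℚ) :+ :- (con 0ℚ :* qb :+ pb :* con 0ℚ) := x)
  refl (E a b p q) (δ p a) (δ p b) (δ q a) (δ q b)

-- Enumeration of pairs

-- The recursion that `pair` follows; by it `choose₂ (2 + m)` is definitionally `suc (chords m)`.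
choose₂ : ℕ → ℕ
choose₂ zero    = 0
choose₂ (suc k) = k ℕ.+ choose₂ k

-- The pairs starting with `zero` come first, so that number 0 computes to the pair of `zero` and
-- `suc zero`.
pair : ∀ k → Fin (choose₂ k) → Fin k × Fin k
pair (suc k) t = [ (λ b → zero , suc b) , (λ u → Product.map suc suc (pair k u)) ]′ (splitAt k t)

pair-< : ∀ k t → proj₁ (pair k t) < proj₂ (pair k t)
pair-< (suc k) t with splitAt k t
... | inj₁ b = ℕ.s≤s ℕ.z≤n
... | inj₂ u = ℕ.s≤s (pair-< k u)

splitAt-injective : ∀ m {n} {t u : Fin (m ℕ.+ n)} → splitAt m t ≡ splitAt m u → t ≡ u
splitAt-injective m {n} {t} {u} e =
  ≡.trans (≡.sym (join-splitAt m n t)) (≡.trans (≡.cong (join m n) e) (join-splitAt m n u))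

pair-injective : ∀ k {t u} → pair k t ≡ pair k u → t ≡ u
pair-injective (suc k) {t} {u} e with splitAt k t in eₜ | splitAt k u in eᵤ
... | inj₁ b | inj₁ c = splitAt-injective k
  (≡.trans eₜ (≡.trans (≡.cong inj₁ (suc-injective (≡.cong proj₂ e))) (≡.sym eᵤ)))
... | inj₁ b | inj₂ v = contradiction (≡.cong proj₁ e) λ ()
... | inj₂ v | inj₁ c = contradiction (≡.cong proj₁ e) λ ()
... | inj₂ v | inj₂ w = splitAt-injective k
  (≡.trans eₜ (≡.trans (≡.cong inj₂ (pair-injective k v≡w)) (≡.sym eᵤ)))
  where
  v≡w : pair k v ≡ pair k w
  v≡w = ≡.cong₂ _,_ (suc-injective (≡.cong proj₁ e)) (suc-injective (≡.cong proj₂ e))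

pair-surjective : ∀ k {a b} → a < b → ∃ λ t → pair k t ≡ (a , b)
pair-surjective (suc k) {zero} {suc b} _ = join k (choose₂ k) (inj₁ b) ,
  ≡.cong [ _ , _ ]′ (splitAt-join k (choose₂ k) (inj₁ b))
pair-surjective (suc k) {suc a} {suc b} (ℕ.s≤s a<b) with t , e ← pair-surjective k a<b =
  join k (choose₂ k) (inj₂ t) ,
  ≡.trans (≡.cong [ _ , _ ]′ (splitAt-join k (choose₂ k) (inj₂ t))) (≡.cong (Product.map suc suc) e)

-- The formula k (k - 1) / 2 with division and subtraction moved across, which leaves semiring
-- identities.
choose₂-double : ∀ k → choose₂ k * 2 ℕ.+ k ≡ k * k
choose₂-double zero    = ≡.refl
choose₂-double (suc k) = ≡.trans (regroup k (choose₂ k))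
  (≡.trans (≡.cong (ℕ._+ (1 ℕ.+ 2 * k)) (choose₂-double k)) (square k))
  where
  regroup : ∀ k c → (k ℕ.+ c) * 2 ℕ.+ suc k ≡ (c * 2 ℕ.+ k) ℕ.+ (1 ℕ.+ 2 * k)
  regroup = solveℕ 2 (λ k c → (k :⊕ c) :⊗ conℕ 2 :⊕ (conℕ 1 :⊕ k)
    :≡ (c :⊗ conℕ 2 :⊕ k) :⊕ (conℕ 1 :⊕ conℕ 2 :⊗ k)) ≡.refl
  square : ∀ k → k * k ℕ.+ (1 ℕ.+ 2 * k) ≡ suc k * suc k
  square = solveℕ 1 (λ k → k :⊗ k :⊕ (conℕ 1 :⊕ conℕ 2 :⊗ k) :≡ (conℕ 1 :⊕ k) :⊗ (conℕ 1 :⊕ k)) ≡.refl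

-- A pair (a , b) in Fin (2 + m) stands for the edge joining suc a and suc b; the pair
-- numbered 0 is the edge 12, which is not a chord, so the numbering of chords is shifted by one.
chords : ℕ → ℕ
chords m = m ℕ.+ choose₂ (suc m)

-- With n = 3 + m, twice `chords m` is n m, so the division by 2 is exact.
chords≡ : ∀ m → (3 ℕ.+ m) * m / 2 ≡ chords m
chords≡ m = ≡.trans (≡.cong (_/ 2) (≡.sym double)) (m*n/n≡m (chords m) 2)
  where
  regroup : ∀ m c → (m ℕ.+ (m ℕ.+ c)) * 2 ≡ (c * 2 ℕ.+ m) ℕ.+ 3 * m
  regroup = solveℕ 2 (λ m c → (m :⊕ (m :⊕ c)) :⊗ conℕ 2 :≡ (c :⊗ conℕ 2 :⊕ m) :⊕ conℕ 3 :⊗ m) ≡.refl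
  expand : ∀ m → m * m ℕ.+ 3 * m ≡ (3 ℕ.+ m) * m
  expand = solveℕ 1 (λ m → m :⊗ m :⊕ conℕ 3 :⊗ m :≡ (conℕ 3 :⊕ m) :⊗ m) ≡.refl
  double : chords m * 2 ≡ (3 ℕ.+ m) * m
  double = ≡.trans (regroup m (choose₂ m))
    (≡.trans (≡.cong (ℕ._+ 3 * m) (choose₂-double m)) (expand m))

-- A basis of the balanced graphs

module _ {m : ℕ} where

  chord : Fin (chords m) → Fin (2 ℕ.+ m) × Fin (2 ℕ.+ m)
  chord t = pair (2 ℕ.+ m) (suc t)

  chord-≢01 : ∀ (t : Fin (chords m)) → ¬ SameEdge zero (suc zero) (proj₁ (chord t)) (proj₂ (chord t))
  chord-≢01 t (inj₁ (a≡0 , b≡1)) = contradiction (pair-injective (2 ℕ.+ m) {suc t} {zero} (≡.cong₂ _,_ a≡0 b≡1)) λ ()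
  chord-≢01 t (inj₂ (a≡1 , b≡0)) = contradiction (≡.subst₂ _<_ a≡1 b≡0 (pair-< (2 ℕ.+ m) (suc t))) λ ()

  -- Chords are listed as increasing pairs, so a reversed match would give both a < b and b < a; a
  -- direct match is settled by injectivity.
  chord-sameEdge : ∀ (t u : Fin (chords m)) →
    SameEdge (proj₁ (chord t)) (proj₂ (chord t)) (proj₁ (chord u)) (proj₂ (chord u)) → u ≡ t
  chord-sameEdge t u (inj₁ (a≡ , b≡)) = suc-injective (pair-injective (2 ℕ.+ m) (≡.cong₂ _,_ a≡ b≡))
  chord-sameEdge t u (inj₂ (a≡ , b≡)) = contradiction
    (≡.subst₂ _<_ a≡ b≡ (pair-< (2 ℕ.+ m) (suc u))) (<-asym (pair-< (2 ℕ.+ m) (suc t)))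

  chord-≢ : ∀ (t : Fin (chords m)) → proj₁ (chord t) ≢ proj₂ (chord t)
  chord-≢ t = <⇒≢ (pair-< (2 ℕ.+ m) (suc t))

  chordBasis : Fin (chords m) → Graph (3 ℕ.+ m)
  chordBasis t = chordGraph (proj₁ (chord t)) (proj₂ (chord t)) (chord-≢ t)

  chordBasis∈ℂ : ∀ (t : Fin (chords m)) → chordBasis t ∈ ℂ (3 ℕ.+ m)
  chordBasis∈ℂ t = chordGraph∈ℂ (chord-≢ t) b≢0 b≢1
    where
    a = proj₁ (chord t)
    b = proj₂ (chord t)
    a<b : a < b
    a<b = pair-< (2 ℕ.+ m) (suc t)

    b≢0 : b ≢ zero
    b≢0 b≡0 = contradiction (≡.subst (a <_) b≡0 a<b) λ ()

    <1⇒≡0 : ∀ {k} {i : Fin (2 ℕ.+ k)} → i < suc {suc k} zero → i ≡ zero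
    <1⇒≡0 {i = zero}  _             = ≡.refl
    <1⇒≡0 {i = suc _} (ℕ.s≤s ())

    -- As a < b, the value 1 for b leaves only 0 for a, and that pair is the edge 12.
    b≢1 : b ≢ suc zero
    b≢1 b≡1 = chord-≢01 t (inj₁ (<1⇒≡0 (≡.subst (a <_) b≡1 a<b) , b≡1))

  chordWeight : Graph (3 ℕ.+ m) → Fin (chords m) → ℝ
  chordWeight 𝒢 t = weight 𝒢 (suc (proj₁ (chord t))) (suc (proj₂ (chord t)))

  -- Among the edges avoiding vertex 0 the subtracted triangle sees only 12, which is no chord.
  chordWeight-chordBasis : ∀ (t u : Fin (chords m)) →
    chordWeight (chordBasis t) u ≃ E (proj₁ (chord t)) (proj₂ (chord t)) (proj₁ (chord u)) (proj₂ (chord u))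
  chordWeight-chordBasis t u = begin
    chordWeight (chordBasis t) u
      ≈⟨ +-cong (weight-triangle (chord-≢ t) p q) (-‿cong (weight-triangle {2 ℕ.+ m} {zero} {suc zero} (λ ()) p q)) ⟩
    E a b p q + - E zero (suc zero) p q  ≈⟨ +-congˡ (-‿cong (E-0 zero (suc zero) p q (chord-≢01 u))) ⟩
    E a b p q + - 0ℝ                     ≈⟨ solve 1 (λ x → x :+ :- con 0ℚ := x) refl (E a b p q) ⟩
    E a b p q                            ∎
    where
    a = proj₁ (chord t)
    b = proj₂ (chord t)
    p = proj₁ (chord u)
    q = proj₂ (chord u)

  -- Chord weights are dual to `chordBasis` and read off coefficients; this yields independence and
  -- also names the coefficients for spanning.
  chordWeight-linearCombination : ∀ (c : Fin (chords m) → ℝ) u →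
    chordWeight (linearCombination (3 ℕ.+ m) c chordBasis) u ≃ c u
  chordWeight-linearCombination c u = begin
    chordWeight (linearCombination (3 ℕ.+ m) c chordBasis) u
      ≈⟨ weight-linearCombination c chordBasis _ _ ⟩
    ∑[ t < chords m ] (c t · chordWeight (chordBasis t) u)
      ≈⟨ sum-single u (λ t t≢u → trans (·-congˡ (trans (chordWeight-chordBasis t u)
           (E-0 _ _ _ _ (t≢u ∘ ≡.sym ∘ chord-sameEdge t u)))) (zeroʳ (c t))) ⟩
    c u · chordWeight (chordBasis u) u
      ≈⟨ ·-congˡ (trans (chordWeight-chordBasis u u) (E-1 (chord-≢ u))) ⟩
    c u · 1ℝ
      ≈⟨ ·-identityʳ (c u) ⟩
    c u ∎

  -- The rows of the vertices outside the triangle 012 kill their edges to 0; then the rows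
  -- of 0, 1, 2 force the three weights of that triangle to sum to zero in pairs.
  balanced-chordless⇒0 : ∀ {𝒢 : Graph (3 ℕ.+ m)} → 𝒢 ∈ Balanced (3 ℕ.+ m) →
    (∀ t → chordWeight 𝒢 t ≃ 0ℝ) → 𝒢 ≈ᴳ 0ᴳ
  balanced-chordless⇒0 {𝒢} bal chordless = mk≈ᴳ entry
    where
    w = weight 𝒢

    ascending : ∀ {a b} → a < b → ¬ SameEdge zero (suc zero) a b → w (suc a) (suc b) ≃ 0ℝ
    ascending {a} {b} a<b ¬01 with pair-surjective (2 ℕ.+ m) a<b
    -- Number 0 of the enumeration is the edge 12, excluded by hypothesis; the other numbers are
    -- chords.
    ... | zero  , ≡.refl = contradiction (inj₁ (≡.refl , ≡.refl)) ¬01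
    ... | suc t , e      = ≡.subst (λ ab → w (suc (proj₁ ab)) (suc (proj₂ ab)) ≃ 0ℝ) e (chordless t)

    away : ∀ a b → ¬ SameEdge zero (suc zero) a b → w (suc a) (suc b) ≃ 0ℝ
    away a b ¬01 with <-cmp a b
    ... | tri< a<b _ _    = ascending a<b ¬01
    ... | tri≈ _ ≡.refl _ = loopless 𝒢 (suc a)
    ... | tri> _ _ b<a    = trans (symmetric 𝒢 (suc a) (suc b)) (ascending b<a λ
      { (inj₁ (b≡0 , a≡1)) → ¬01 (inj₂ (a≡1 , b≡0))
      ; (inj₂ (b≡1 , a≡0)) → ¬01 (inj₁ (a≡0 , b≡1)) })

    x y z : ℝ
    x = w (suc zero) (suc (suc zero))
    y = w (suc zero) zero
    z = w (suc (suc zero)) zero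

    spoke : ∀ c → w (suc (suc (suc c))) zero ≃ 0ℝ
    spoke c = begin
      w p zero                               ≈⟨ +-identityʳ _ ⟨
      w p zero + 0ℝ                          ≈⟨ +-congˡ (sum-zero λ b → away (suc (suc c)) b λ { (inj₁ ()) ; (inj₂ (() , _)) }) ⟨
      rowSum 𝒢 p                             ≈⟨ bal p ⟩
      0ℝ                                     ∎
      where p = suc (suc (suc c))

    row₀ : y + z ≃ 0ℝ
    row₀ = begin
      y + z                     ≈⟨ solve 2 (λ y z → y :+ z := con 0ℚ :+ (y :+ (z :+ con 0ℚ))) refl y z ⟩
      0ℝ + (y + (z + 0ℝ))       ≈⟨ +-cong (loopless 𝒢 zero) (+-cong (symmetric 𝒢 zero (suc zero)) (+-cong (symmetric 𝒢 zero (suc (suc zero)))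
                                     (sum-zero λ c → trans (symmetric 𝒢 zero (suc (suc (suc c)))) (spoke c)))) ⟨
      rowSum 𝒢 zero             ≈⟨ bal zero ⟩
      0ℝ                        ∎

    row₁ : y + x ≃ 0ℝ
    row₁ = begin
      y + x                     ≈⟨ solve 2 (λ y x → y :+ x := y :+ (con 0ℚ :+ (x :+ con 0ℚ))) refl y x ⟩
      y + (0ℝ + (x + 0ℝ))       ≈⟨ +-congˡ (+-cong (loopless 𝒢 (suc zero)) (+-congˡ
                                     (sum-zero λ c → away zero (suc (suc c)) λ { (inj₁ (_ , ())) ; (inj₂ (_ , ())) }))) ⟨
      rowSum 𝒢 (suc zero)       ≈⟨ bal (suc zero) ⟩
      0ℝ                        ∎

    row₂ : z + x ≃ 0ℝ
    row₂ = begin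
      z + x                     ≈⟨ solve 2 (λ z x → z :+ x := z :+ (x :+ (con 0ℚ :+ con 0ℚ))) refl z x ⟩
      z + (x + (0ℝ + 0ℝ))       ≈⟨ +-congˡ (+-cong (symmetric 𝒢 (suc (suc zero)) (suc zero)) (+-cong (loopless 𝒢 (suc (suc zero)))
                                     (sum-zero λ c → away (suc zero) (suc (suc c)) λ { (inj₁ (_ , ())) ; (inj₂ (_ , ())) }))) ⟨
      rowSum 𝒢 (suc (suc zero)) ≈⟨ bal (suc (suc zero)) ⟩
      0ℝ                        ∎

    pairwise-0 : ∀ {x y z} → y + z ≃ 0ℝ → y + x ≃ 0ℝ → z + x ≃ 0ℝ → x ≃ 0ℝ
    pairwise-0 {x} {y} {z} yz yx zx = begin
      x                                                  ≈⟨ solve 3 (λ x y z → x := con ½ :* ((y :+ x) :+ (z :+ x) :+ :- (y :+ z))) refl x y z ⟩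
      fromℚ ½ · ((y + x) + (z + x) + - (y + z))          ≈⟨ ·-congˡ (+-cong (+-cong yx zx) (-‿cong yz)) ⟩
      fromℚ ½ · (0ℝ + 0ℝ + - 0ℝ)                         ≈⟨ ≗⇒≃ (λ _ → ≡.refl) ⟩
      0ℝ                                                 ∎

    -- The edges 10 and 20 in turn take the place of `x` in `pairwise-0`, hence the flipped sums.
    apex : ∀ a → w (suc a) zero ≃ 0ℝ
    apex zero          = pairwise-0 (trans (+-comm x z) row₂) (trans (+-comm x y) row₁) (trans (+-comm z y) row₀)
    apex (suc zero)    = pairwise-0 (trans (+-comm x y) row₁) (trans (+-comm x z) row₂) row₀
    apex (suc (suc c)) = spoke c

    entry : ∀ i j → w i j ≃ 0ℝ
    entry zero    zero    = loopless 𝒢 zero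
    entry zero    (suc b) = trans (symmetric 𝒢 zero (suc b)) (apex b)
    entry (suc a) zero    = apex a
    entry (suc a) (suc b) with sameEdge? zero (suc zero) a b
    ... | no  ¬01                     = away a b ¬01
    ... | yes (inj₁ (≡.refl , ≡.refl)) = pairwise-0 row₀ row₁ row₂
    ... | yes (inj₂ (≡.refl , ≡.refl)) = trans (symmetric 𝒢 (suc a) (suc b)) (pairwise-0 row₀ row₁ row₂)

  -- The difference of the two sides is balanced and, by duality, has zero weight on every chord, so
  -- it vanishes.
  balanced-spanned : ∀ {𝒢 : Graph (3 ℕ.+ m)} → 𝒢 ∈ Balanced (3 ℕ.+ m) →
    𝒢 ≈ᴳ linearCombination (3 ℕ.+ m) (chordWeight 𝒢) chordBasis
  balanced-spanned {𝒢} bal = x∙y⁻¹≈ε⇒x≈y 𝒢 ℋ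
    (balanced-chordless⇒0 {𝒢 = 𝒢 +ᴳ -ᴳ ℋ}
      (+-closed 𝒮 {𝒢} { -ᴳ ℋ} bal (-ᴳ-closed 𝒮 {ℋ} ℋ-balanced))
      (λ t → trans (+-congˡ (-‿cong (chordWeight-linearCombination (chordWeight 𝒢) t))) (-‿inverseʳ _)))
    where
    open IsSubspace
    open GroupProperties (Module.+ᴹ-group (𝔾 (3 ℕ.+ m))) using (x∙y⁻¹≈ε⇒x≈y)
    𝒮 = Balanced-isSubspace (3 ℕ.+ m)
    ℋ = linearCombination (3 ℕ.+ m) (chordWeight 𝒢) chordBasis
    ℋ-balanced : ℋ ∈ Balanced (3 ℕ.+ m)
    ℋ-balanced = linearCombination∈ 𝒮 (chordWeight 𝒢) chordBasis
      λ t → ℂ⊆Balanced {𝒢 = chordBasis t} (chordBasis∈ℂ t)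

  Balanced⊆ℂ : ∀ {𝒢 : Graph (3 ℕ.+ m)} → 𝒢 ∈ Balanced (3 ℕ.+ m) → 𝒢 ∈ ℂ (3 ℕ.+ m)
  Balanced⊆ℂ {𝒢} bal = respects-≈ 𝒮 (≈ᴹ-sym (balanced-spanned {𝒢 = 𝒢} bal))
    (linearCombination∈ 𝒮 (chordWeight 𝒢) chordBasis chordBasis∈ℂ)
    where
    open IsSubspace
    open Module (𝔾 (3 ℕ.+ m)) using (≈ᴹ-sym)
    𝒮 = ℂ-isSubspace (3 ℕ.+ m)

  ℂ-dimension : HasDimension (3 ℕ.+ m) (ℂ (3 ℕ.+ m)) (chords m)
  ℂ-dimension = chordBasis , record
    { contained   = chordBasis∈ℂ
    ; independent = λ c e t → trans (sym (chordWeight-linearCombination c t))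
        (weights-≃ e (suc (proj₁ (chord t))) (suc (proj₂ (chord t))))
    ; spanning    = λ w w∈ℂ → chordWeight w , balanced-spanned {𝒢 = w} (ℂ⊆Balanced {𝒢 = w} w∈ℂ)
    }

-- The orthogonal decomposition

subtract-cpi∈ℂ : ∀ {m} (𝒢 : Graph (3 ℕ.+ m)) (ω : Fin (3 ℕ.+ m) → ℝ) →
  (∀ p → rowSum (cpi ω) p ≃ rowSum 𝒢 p) → 𝒢 +ᴳ -ᴳ cpi ω ∈ ℂ (3 ℕ.+ m)
subtract-cpi∈ℂ 𝒢 ω rowSums = Balanced⊆ℂ {𝒢 = 𝒢 +ᴳ -ᴳ cpi ω} λ p → begin
  rowSum (𝒢 +ᴳ -ᴳ cpi ω) p          ≈⟨ rowSum-+ 𝒢 (-ᴳ cpi ω) p ⟩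
  rowSum 𝒢 p + rowSum (-ᴳ cpi ω) p  ≈⟨ +-congˡ (trans (rowSum-neg (cpi ω) p) (-‿cong (rowSums p))) ⟩
  rowSum 𝒢 p + - rowSum 𝒢 p         ≈⟨ -‿inverseʳ (rowSum 𝒢 p) ⟩
  0ℝ                                ∎

+-subtract : ∀ {n} (𝒢 ℋ : Graph n) → 𝒢 ≈ᴳ ℋ +ᴳ (𝒢 +ᴳ -ᴳ ℋ)
+-subtract 𝒢 ℋ = mk≈ᴳ λ p q →
  solve 2 (λ x y → x := y :+ (x :+ :- y)) refl (weight 𝒢 p q) (weight ℋ p q)

-- The part in `ℂℙ𝕀` is chosen to have the row sums of 𝒢; the remainder is then balanced, hence in
-- `ℂ`.
decomposition : ∀ {m} (𝒢 : Graph (3 ℕ.+ m)) → ∃ λ 𝒢cpi → ∃ λ 𝒢cyclic →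
  𝒢cpi ∈ ℂℙ𝕀 (3 ℕ.+ m) × 𝒢cyclic ∈ ℂ (3 ℕ.+ m) × 𝒢 ≈ᴳ 𝒢cpi +ᴳ 𝒢cyclic
decomposition {m} 𝒢 = cpi ω , 𝒢 +ᴳ -ᴳ cpi ω , cpi∈ , cyclic∈ , sum≈
  where
  ω = proj₁ (cpi-with-rowSums (rowSum 𝒢))
  cpi∈ : cpi ω ∈ ℂℙ𝕀 (3 ℕ.+ m)
  cpi∈ = cpi∈ℂℙ𝕀 ω
  cyclic∈ : 𝒢 +ᴳ -ᴳ cpi ω ∈ ℂ (3 ℕ.+ m)
  cyclic∈ = subtract-cpi∈ℂ 𝒢 ω (proj₂ (cpi-with-rowSums (rowSum 𝒢)))
  sum≈ : 𝒢 ≈ᴳ cpi ω +ᴳ (𝒢 +ᴳ -ᴳ cpi ω)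
  sum≈ = +-subtract 𝒢 (cpi ω)

theorem11 : (n : ℕ) → 4 ≤ n →
    (IsSubspace n (ℂℙ𝕀 n) × HasDimension n (ℂℙ𝕀 n) n) ×
    (IsSubspace n (ℂ n) × HasDimension n (ℂ n) (n * (n ∸ 3) / 2)) ×
    IsOrthogonalDirectSum n (ℂℙ𝕀 n) (ℂ n) ×
    ((𝒢 : Graph n) → ∃ λ 𝒢cpi → ∃ λ 𝒢cyclic →
    (𝒢cpi ∈ ℂℙ𝕀 n × 𝒢cyclic ∈ ℂ n × 𝒢 ≈ᴳ 𝒢cpi +ᴳ 𝒢cyclic) ×
    (∀ ℋ 𝒦 → ℋ ∈ ℂℙ𝕀 n → 𝒦 ∈ ℂ n → 𝒢 ≈ᴳ ℋ +ᴳ 𝒦 → ℋ ≈ᴳ 𝒢cpi × 𝒦 ≈ᴳ 𝒢cyclic) ×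
    IsOrthogonalProjection n (ℂℙ𝕀 n) 𝒢 𝒢cpi ×
    IsOrthogonalProjection n (ℂ n) 𝒢 𝒢cyclic)
theorem11 0 ()
theorem11 1 (ℕ.s≤s ())
theorem11 2 (ℕ.s≤s (ℕ.s≤s ()))
theorem11 n@(suc (suc (suc m))) _ =
  (ℂℙ𝕀-isSubspace n , ℂℙ𝕀-dimension m) ,
  (ℂ-isSubspace n , ≡.subst (HasDimension n (ℂ n)) (≡.sym (chords≡ m)) (ℂ-dimension)) ,
  record
    { sum-is-everything    = decomposition
    ; trivial-intersection = λ v → disjoint {v}
    ; orthogonal           = λ u w → ℂℙ𝕀⟂ℂ {u} {w}
    } ,
  λ 𝒢 → let (𝒰 , 𝒲 , 𝒰∈ , 𝒲∈ , e) = decomposition 𝒢 in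
    𝒰 , 𝒲 , (𝒰∈ , 𝒲∈ , e) ,
    (λ ℋ 𝒦 ℋ∈ 𝒦∈ f → unique ℋ∈ 𝒰∈ 𝒦∈ 𝒲∈ (≈ᴹ-trans (≈ᴹ-sym f) e)) ,
    record
      { projection∈W        = 𝒰∈
      -- The residual of 𝒰 is 𝒲. Symmetry of the inner product brings the member of `ℂℙ𝕀` to the
      -- left, as `ℂℙ𝕀⟂ℂ` expects.
      ; residual-orthogonal = λ w w∈ → trans (⟨⟩ᴳ-comm (𝒢 +ᴳ -ᴳ 𝒰) w)
          (ℂℙ𝕀⟂ℂ {w} {𝒢 +ᴳ -ᴳ 𝒰} w∈ (respects-≈ (ℂ-isSubspace n) (≈ᴹ-sym (residual (≈ᴹ-trans e (+ᴹ-comm 𝒰 𝒲)))) 𝒲∈))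
      } ,
    record
      { projection∈W        = 𝒲∈
      ; residual-orthogonal = λ w w∈ →
          ℂℙ𝕀⟂ℂ {𝒢 +ᴳ -ᴳ 𝒲} {w} (respects-≈ (ℂℙ𝕀-isSubspace n) (≈ᴹ-sym (residual e)) 𝒰∈) w∈
      }
  where
  open IsSubspace
  open Module (𝔾 n) using (≈ᴹ-sym; ≈ᴹ-trans; +ᴹ-comm; +ᴹ-group)
  open GroupProperties +ᴹ-group using (x∙y⁻¹≈ε⇒x≈y)

  disjoint : ∀ {v} → v ∈ ℂℙ𝕀 n → v ∈ ℂ n → v ≈ᴳ 0ᴳ
  disjoint {v} v∈ℂℙ𝕀 v∈ℂ = ℂℙ𝕀∩Balanced {𝒢 = v} v∈ℂℙ𝕀 (ℂ⊆Balanced {𝒢 = v} v∈ℂ)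

  ℂℙ𝕀⟂ℂ : ∀ {u w} → u ∈ ℂℙ𝕀 n → w ∈ ℂ n → ⟨ u , w ⟩ᴳ ≃ 0ℝ
  ℂℙ𝕀⟂ℂ {u} {w} u∈ w∈ = ℂℙ𝕀⟂Balanced {𝒢 = u} {w} u∈ (ℂ⊆Balanced {𝒢 = w} w∈)

  residual : ∀ {v u w} → v ≈ᴳ u +ᴳ w → v +ᴳ -ᴳ w ≈ᴳ u
  residual {v} {u} {w} e = mk≈ᴳ λ p q → trans (+-congʳ (weights-≃ e p q))
    (solve 2 (λ x y → (x :+ y) :+ :- y := x) refl (weight u p q) (weight w p q))

  -- u - u′ equals w′ - w, so it lies in both subspaces and is zero; cancelling u then identifies w
  -- with w′.
  unique : ∀ {u u′ w w′} → u ∈ ℂℙ𝕀 n → u′ ∈ ℂℙ𝕀 n → w ∈ ℂ n → w′ ∈ ℂ n →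
    u +ᴳ w ≈ᴳ u′ +ᴳ w′ → u ≈ᴳ u′ × w ≈ᴳ w′
  unique {u} {u′} {w} {w′} u∈ u′∈ w∈ w′∈ e = x∙y⁻¹≈ε⇒x≈y u u′ u-u′≈0 , mk≈ᴳ λ p q → begin
    weight w p q                                         ≈⟨ solve 2 (λ u w → w := (u :+ w) :+ :- u) refl (weight u p q) (weight w p q) ⟩
    (weight u p q + weight w p q) + - weight u p q       ≈⟨ +-cong (weights-≃ e p q) (-‿cong (weights-≃ u≈u′ p q)) ⟩
    (weight u′ p q + weight w′ p q) + - weight u′ p q    ≈⟨ solve 2 (λ u w → (u :+ w) :+ :- u := w) refl (weight u′ p q) (weight w′ p q) ⟩
    weight w′ p q                                        ∎
    where
    swap : w′ +ᴳ -ᴳ w ≈ᴳ u +ᴳ -ᴳ u′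
    swap = mk≈ᴳ λ p q → begin
      weight w′ p q + - weight w p q
        ≈⟨ solve 3 (λ w u′ w′ → w′ :+ :- w := (u′ :+ w′) :+ (:- u′ :+ :- w)) refl (weight w p q) (weight u′ p q) (weight w′ p q) ⟩
      (weight u′ p q + weight w′ p q) + (- weight u′ p q + - weight w p q)
        ≈⟨ +-congʳ (weights-≃ e p q) ⟨
      (weight u p q + weight w p q) + (- weight u′ p q + - weight w p q)
        ≈⟨ solve 3 (λ u w u′ → (u :+ w) :+ (:- u′ :+ :- w) := u :+ :- u′) refl (weight u p q) (weight w p q) (weight u′ p q) ⟩
      weight u p q + - weight u′ p q ∎

    u-u′≈0 : u +ᴳ -ᴳ u′ ≈ᴳ 0ᴳ
    u-u′≈0 = disjoint {u +ᴳ -ᴳ u′}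
      (+-closed (ℂℙ𝕀-isSubspace n) {u} { -ᴳ u′} u∈ (-ᴳ-closed (ℂℙ𝕀-isSubspace n) {u′} u′∈))
      (respects-≈ (ℂ-isSubspace n) swap (+-closed (ℂ-isSubspace n) w′∈ (-ᴳ-closed (ℂ-isSubspace n) w∈)))

    u≈u′ : u ≈ᴳ u′
    u≈u′ = x∙y⁻¹≈ε⇒x≈y u u′ u-u′≈0
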